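{- For every fixed $K>5$, there are only finitely many odd perfect numbers $N$ such that for some prime $q$ and integer $\alpha\ge 1$ with $q^{\alpha}\,\|\,N$ we have $$\frac{\sigma(N/q^{\alpha})}{q^{\alpha}}<K.$$ Moreover, all such $N$ are bounded by some effectively computable number depending only on $K$.
   Context: For a positive integer $n$, $\sigma(n)$ denotes the sum of the positive divisors of $n$. A positive integer $N$ is perfect if $\sigma(N)=2N$. The notation $q^{\alpha}\,\|\,N$ means that $q^{\alpha}\mid N$ but $q^{\alpha+1}\nmid N$. -}

module Defs where

open import Data.Integer.Base using (+_)
open import Data.List.Base using (filter; map; upTo)
open import Data.List.Membership.Propositional using (_∈_)
open import Data.Nat.Base as ℕ using (ℕ; suc; NonZero; _*_; _^_)
open import Data.Nat.Divisibility using (_∣_; _∤_; _∣?_)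
open import Data.Nat.ListAction using (sum)
open import Data.Nat.Primality using (Prime; prime⇒nonZero)
open import Data.Nat.Properties using (m^n≢0)
open import Data.Product.Base using (_×_; ∃-syntax; Σ-syntax)
open import Data.Rational.Base as ℚ using (ℚ)
open import Data.Sum.Base using (_⊎_)
open import Function.Bundles using (_⇔_)
open import Relation.Binary.PropositionalEquality.Core using (_≡_)
open import Relation.Nullary.Negation.Core using (¬_)

σ : ℕ → ℕ
σ n = sum (filter (_∣? n) (map suc (upTo n)))

-- Positivity is needed because σ 0 ≡ 2 * 0.
Perfect : ℕ → Set
Perfect N = NonZero N × σ N ≡ 2 * N

OddPerfect : ℕ → Set
OddPerfect N = 2 ∤ N × Perfect N

infix 4 _^_∥_

_^_∥_ : ℕ → ℕ → ℕ → Set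
q ^ α ∥ N = q ^ α ∣ N × q ^ suc α ∤ N

-- The rational number σ(N / q^α) / q^α.  The inner division is the one of ℕ,
-- which is exact whenever q ^ α ∣ N.
index : (N q α : ℕ) .{{_ : NonZero q}} → ℚ
index N q α = (+ σ (N ℕ./ (q ^ α))) ℚ./ (q ^ α)
  where instance _ = m^n≢0 q α

-- Dedekind reals.  The existentials and the disjunction are untruncated, so a
-- real comes with data from which rational approximations can be computed.
record ℝ : Set₁ where
  field
    Lower Upper    : ℚ → Set
    lowerInhabited : ∃[ p ] Lower p
    upperInhabited : ∃[ r ] Upper r
    lowerRounded   : ∀ p → Lower p ⇔ (∃[ r ] p ℚ.< r × Lower r)
    upperRounded   : ∀ r → Upper r ⇔ (∃[ p ] p ℚ.< r × Upper p)
    disjoint       : ∀ p → ¬ (Lower p × Upper p)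
    located        : ∀ p r → p ℚ.< r → Lower p ⊎ Upper r

infix 4 _<ℝ_

-- A rational is less than a real exactly when it belongs to its lower cut.
_<ℝ_ : ℚ → ℝ → Set
p <ℝ K = ℝ.Lower K p

SmallIndex : ℝ → ℕ → Set
SmallIndex K N =
  ∃[ q ] ∃[ α ] Σ[ p ∈ Prime q ]
    1 ℕ.≤ α × q ^ α ∥ N × index N q α {{prime⇒nonZero p}} <ℝ K

FinitelyMany : (ℕ → Set) → Set
FinitelyMany P = ∃[ xs ] (∀ n → P n → n ∈ xs)

{-# OPTIONS --safe #-}
module Submission where

-- Write N = q^α m with q prime to m.  As q^α is prime to σ(q^α), the index
-- t = σ(m) / q^α is an integer, and 2m = t σ(q^α).
--
-- For p^e ∥ m write σ(p^e) = q^β u with q ∤ u.  The product of the u divides t,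
-- so fewer than t of them differ from 1; few primes p divide t as well.  For any
-- other p we have q^β = σ(p^e) ≡ 1 + p and q^(α+1) ≡ 1 modulo p², and computing
-- q^(β(α+1)) in two ways gives p ∣ α + 1.  If r and s are two such primes, then
-- for each further one p the numbers q^(rp) - 1 and q^(sp) - 1 have primitive
-- prime divisors, which all divide m.  With k such primes, m therefore has at
-- least 2 (k - 2) prime divisors but at most k + 2t + 1, so the number of prime
-- divisors of N is bounded in terms of t.
--
-- An odd perfect number with a bounded number of prime divisors is bounded, by
-- an argument in the style of Heath-Brown that bounds one prime, or one full
-- prime power, at a time.

open import Defs
open import Data.Fin.Base as Fin using (Fin; toℕ; fromℕ<)
import Data.Fin.Properties as Fin
import Data.Integer.Base as ℤ
import Data.Integer.Properties as ℤ
open import Data.List.Base using (List; []; _∷_; _++_; map; filter; length; upTo)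
open import Data.List.Membership.Propositional using (_∈_)
open import Data.List.Membership.Propositional.Properties
open import Data.List.Membership.Propositional.Properties.WithK using (unique∧set⇒bag)
open import Data.List.Properties using (length-map; length-++; length-upTo; filter-accept)
open import Data.List.Relation.Binary.BagAndSetEquality using (∼bag⇒↭)
open import Data.List.Relation.Binary.Permutation.Propositional using (_↭_; ↭-refl; ↭-trans; ↭-prep; ↭-swap)
open import Data.List.Relation.Binary.Disjoint.Propositional using (Disjoint)
open import Data.List.Relation.Binary.Permutation.Propositional.Properties using (All-resp-↭; ↭-length; shift; ∈-resp-↭) renaming (map⁺ to ↭-map)
open import Data.List.Relation.Unary.All as All using (All; []; _∷_)
import Data.List.Relation.Unary.All.Properties as All
open import Data.List.Relation.Unary.AllPairs using ([]; _∷_)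
open import Data.List.Relation.Unary.Any using (here; there)
open import Data.List.Relation.Unary.Unique.Propositional using (Unique)
open import Data.List.Relation.Unary.Unique.Propositional.Properties using (filter⁺; upTo⁺) renaming (map⁺ to unique-map; ++⁺ to unique-++)
open import Data.Nat.Base renaming (_/_ to _div_)
open import Data.Nat.Coprimality as Coprime using (Coprime; coprime-divisor; coprime⇒gcd≡1)
open import Data.Nat.Divisibility
open import Data.Nat.DivMod using (_mod_; m≡m%n+[m/n]*n; m%n<n)
open import Data.Nat.GCD using (gcd; gcd-GCD; gcd[m,n]∣m; gcd[m,n]∣n; module Bézout)
open import Data.Nat.Induction using (<-rec)
open import Data.Nat.ListAction using (sum; product)
open import Data.Nat.ListAction.Properties using (sum-++; sum-↭; product-↭; ∈⇒∣product)
open import Data.Nat.Primality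
open import Data.Nat.Primality.Factorisation using (factorise)
open import Data.Nat.Properties
open import Data.Nat.Tactic.RingSolver using (solve-∀)
open import Data.Product.Base using (_×_; _,_; ∃-syntax; Σ-syntax; proj₁; proj₂; ∃₂)
import Data.Rational.Base as ℚ
import Data.Rational.Properties as ℚ
import Data.Rational.Unnormalised.Base as ℚᵘ
import Data.Rational.Unnormalised.Properties as ℚᵘ
open import Data.Sum.Base using (_⊎_; inj₁; inj₂; [_,_]′)
open import Function.Base using (_∘_; case_of_; id)
open import Function.Bundles using (mk⇔; Equivalence)
open import Relation.Binary.PropositionalEquality hiding ([_])
open import Relation.Nullary.Decidable using (Dec; yes; no; ¬?)
open import Relation.Nullary.Negation using (¬_; contradiction)
open import Relation.Binary.Definitions using (tri<; tri≈; tri>)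

-- Congruence to 1 and orders of powers

infix 4 _≡1mod_

-- One-sided, so that no subtraction occurs: `x` is 1 plus a natural multiple of `n`, in particular
-- positive.
_≡1mod_ : ℕ → ℕ → Set
x ≡1mod n = ∃[ k ] x ≡ 1 + k * n

∣⇒≡1mod : ∀ {x n} → n ∣ x → suc x ≡1mod n
∣⇒≡1mod (divides k eq) = k , cong suc eq

≡1mod⇒∣ : ∀ {x n} → suc x ≡1mod n → n ∣ x
≡1mod⇒∣ (k , eq) = divides k (suc-injective eq)

≡1mod-* : ∀ {x y n} → x ≡1mod n → y ≡1mod n → x * y ≡1mod n
≡1mod-* {n = n} (j , refl) (k , refl) = j + k + j * k * n , eq j k n
  where
  eq : ∀ j k n → (1 + j * n) * (1 + k * n) ≡ 1 + (j + k + j * k * n) * n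
  eq = solve-∀

≡1mod-^ : ∀ {x n} k → x ≡1mod n → x ^ k ≡1mod n
≡1mod-^ zero    x≡1 = 0 , refl
≡1mod-^ (suc k) x≡1 = ≡1mod-* x≡1 (≡1mod-^ k x≡1)

≡1mod-^* : ∀ {x n} a b → x ^ a ≡1mod n → x ^ (a * b) ≡1mod n
≡1mod-^* {x} a b x^a≡1 = subst (_≡1mod _) (^-*-assoc x a b) (≡1mod-^ b x^a≡1)

-- Replaces division by `y`: `x * y` exceeds `x` by `x * (y - 1)`, a multiple of `n`.
≡1mod-cancelʳ : ∀ x {y n} → x * y ≡1mod n → y ≡1mod n → x ≡1mod n
≡1mod-cancelʳ (suc x) {n = n} (j , eq) (k , refl) = ∣⇒≡1mod
  (∣m+n∣m⇒∣n (divides j (suc-injective (trans (sym (expand x k n)) eq))) (divides (k + x * k) refl))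
  where
  expand : ∀ x k n → (1 + x) * (1 + k * n) ≡ 1 + ((k + x * k) * n + x)
  expand = solve-∀

-- Over ℕ a Bézout identity reads `gcd a b + b * v ≡ a * u`, or the same with `a` and `b` exchanged.
-- Raising `x` to both sides leaves a factor that is 1 modulo `n` and can be cancelled.
≡1mod-gcd : ∀ {x n} a b → x ^ a ≡1mod n → x ^ b ≡1mod n → x ^ gcd a b ≡1mod n
≡1mod-gcd {x} {n} a b x^a≡1 x^b≡1 with Bézout.identity (gcd-GCD a b)
... | Bézout.+- u v eq = ≡1mod-cancelʳ (x ^ gcd a b) {y = x ^ (b * v)}
  (subst (_≡1mod n)
    (trans (cong (x ^_) (trans (*-comm a u) (trans (sym eq) (cong (gcd a b +_) (*-comm v b)))))
           (^-distribˡ-+-* x (gcd a b) (b * v)))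
    (≡1mod-^* a u x^a≡1))
  (≡1mod-^* b v x^b≡1)
... | Bézout.-+ u v eq = ≡1mod-cancelʳ (x ^ gcd a b) {y = x ^ (a * u)}
  (subst (_≡1mod n)
    (trans (cong (x ^_) (trans (*-comm b v) (trans (sym eq) (cong (gcd a b +_) (*-comm u a)))))
           (^-distribˡ-+-* x (gcd a b) (a * u)))
    (≡1mod-^* b v x^b≡1))
  (≡1mod-^* a u x^a≡1)

∣∧≡1mod⇒≡1 : ∀ {d x} → d ∣ x → x ≡1mod d → d ≡ 1
∣∧≡1mod⇒≡1 {d} d∣x (k , refl) = ∣1⇒≡1 (∣m+n∣m⇒∣n (subst (d ∣_) (+-comm 1 (k * d)) d∣x) (n∣m*n k))

-- Geometric sums

-- Horner form of the sum of `x ^ i` over `i < n`; thus σ(p^e) is `geom (suc e) p` for a prime p.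
geom : ℕ → ℕ → ℕ
geom zero    x = 0
geom (suc n) x = 1 + x * geom n x

^-geom : ∀ k n → suc k ^ n ≡ 1 + k * geom n (suc k)
^-geom k zero    = cong suc (sym (*-zeroʳ k))
^-geom k (suc n) rewrite ^-geom k n = eq k (geom n (suc k))
  where
  eq : ∀ k g → (1 + k * g) + k * (1 + k * g) ≡ 1 + k * (1 + (g + k * g))
  eq = solve-∀

geom-+ : ∀ m n x → geom (m + n) x ≡ geom m x + x ^ m * geom n x
geom-+ zero    n x = sym (+-identityʳ (geom n x))
geom-+ (suc m) n x rewrite geom-+ m n x = eq x (geom m x) (x ^ m) (geom n x)
  where
  eq : ∀ x a b c → 1 + x * (a + b * c) ≡ (1 + x * a) + x * b * c
  eq = solve-∀

geom-* : ∀ m n x → geom (m * n) x ≡ geom m x * geom n (x ^ m)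
geom-* m zero    x rewrite *-zeroʳ m = sym (*-zeroʳ (geom m x))
geom-* m (suc n) x rewrite *-suc m n | geom-+ m (m * n) x | geom-* m n x =
  eq (geom m x) (x ^ m) (geom n (x ^ m))
  where
  eq : ∀ a b c → a + b * (a * c) ≡ a * (1 + b * c)
  eq = solve-∀

geom-snoc : ∀ n x → geom (suc n) x ≡ x ^ n + geom n x
geom-snoc zero    x = cong suc (*-zeroʳ x)
geom-snoc (suc n) x = begin
  1 + x * geom (suc n) x         ≡⟨ cong (λ g → 1 + x * g) (geom-snoc n x) ⟩
  1 + x * (x ^ n + geom n x)     ≡⟨ eq x (x ^ n) (geom n x) ⟩
  x * x ^ n + (1 + x * geom n x) ∎
  where
  open ≡-Reasoning
  eq : ∀ x a b → 1 + x * (a + b) ≡ x * a + (1 + x * b)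
  eq = solve-∀

^≤geom : ∀ n x → x ^ n ≤ geom (suc n) x
^≤geom n x = ≤-trans (m≤m+n _ _) (≤-reflexive (sym (geom-snoc n x)))

geom<^ : ∀ n {x} → 2 ≤ x → geom n x < x ^ n
geom<^ n {suc k@(suc k′)} (s≤s (s≤s z≤n)) rewrite ^-geom k n = s≤s (m≤m+n (geom n (suc k)) _)

-- The binomial coefficient "n choose 2": the summands run up to `n - 1`, not `n`.
triangular : ℕ → ℕ
triangular zero    = 0
triangular (suc n) = n + triangular n

2*triangular : ∀ n → 2 * triangular n + n ≡ n * n
2*triangular zero    = refl
2*triangular (suc n) = begin
  2 * (n + triangular n) + (1 + n)   ≡⟨ eq n (triangular n) ⟩
  (2 * triangular n + n) + 2 * n + 1 ≡⟨ cong (λ s → s + 2 * n + 1) (2*triangular n) ⟩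
  n * n + 2 * n + 1                  ≡⟨ eq′ n ⟩
  (1 + n) * (1 + n)                  ∎
  where
  open ≡-Reasoning
  eq : ∀ n t → 2 * (n + t) + (1 + n) ≡ (2 * t + n) + 2 * n + 1
  eq = solve-∀
  eq′ : ∀ n → n * n + 2 * n + 1 ≡ (1 + n) * (1 + n)
  eq′ = solve-∀

-- Sums the expansions `(1 + z) ^ i ≡ 1 + i * z` modulo `z * z` over `i < n`; the witness `w`
-- collects the higher terms.
geom-second-order : ∀ n z → ∃[ w ] geom n (1 + z) ≡ n + z * triangular n + z * z * w
geom-second-order zero    z = 0 , eq z
  where
  eq : ∀ z → 0 ≡ z * 0 + z * z * 0
  eq = solve-∀
geom-second-order (suc n) z with geom-second-order n z
... | w , eq = triangular n + w + z * w ,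
  trans (cong (λ g → 1 + (1 + z) * g) eq) (expand n z (triangular n) w)
  where
  expand : ∀ n z t w → 1 + (1 + z) * (n + z * t + z * z * w)
                     ≡ (1 + n) + z * (n + t) + z * z * (t + w + z * w)
  expand = solve-∀

^-second-order : ∀ z n → ∃[ w ] (1 + z) ^ n ≡ 1 + n * z + z * z * w
^-second-order z n with geom-second-order n z
... | w , eq = triangular n + z * w , (begin
  (1 + z) ^ n                                  ≡⟨ ^-geom z n ⟩
  1 + z * geom n (1 + z)                       ≡⟨ cong (λ g → 1 + z * g) eq ⟩
  1 + z * (n + z * triangular n + z * z * w)   ≡⟨ expand n z (triangular n) w ⟩
  1 + n * z + z * z * (triangular n + z * w)   ∎)
  where
  open ≡-Reasoning
  expand : ∀ n z t w → 1 + z * (n + z * t + z * z * w) ≡ 1 + n * z + z * z * (t + z * w)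
  expand = solve-∀

-- Modulo `d` the geometric sum consists of `n` ones.
geom-≡1mod : ∀ {d x} n → x ≡1mod d → d ∣ geom n x → d ∣ n
geom-≡1mod {d} n (k , refl) d∣geom with geom-second-order n (k * d)
... | w , eq = ∣m+n∣m⇒∣n (subst (d ∣_) (trans eq (rotate n (k * d) (triangular n) w)) d∣geom)
                         (∣m⇒∣m*n _ (n∣m*n k))
  where
  rotate : ∀ n z t w → n + z * t + z * z * w ≡ z * (t + z * w) + n
  rotate = solve-∀

∣geom⇒^≡1mod : ∀ {d} x n → d ∣ geom n (suc x) → suc x ^ n ≡1mod d
∣geom⇒^≡1mod x n d∣geom rewrite ^-geom x n = ∣⇒≡1mod (∣n⇒∣m*n x d∣geom)

-- Prime divisors

prime≥2 : ∀ {p} → Prime p → 2 ≤ p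
prime≥2 p-prime = nonTrivial⇒n>1 _ ⦃ prime⇒nonTrivial p-prime ⦄

primeDivisor : ∀ {n} → 2 ≤ n → ∃[ p ] Prime p × p ∣ n
primeDivisor {n} 2≤n with factorise n ⦃ >-nonZero (<-trans z<s 2≤n) ⦄
... | record { factors = []     ; isFactorisation = refl } = contradiction 2≤n λ { (s≤s ()) }
... | record { factors = p ∷ ps ; isFactorisation = refl ; factorsPrime = p-prime ∷ _ } =
  p , p-prime , m∣m*n (product ps)

prime∣prime⇒≡ : ∀ {p q} → Prime p → Prime q → p ∣ q → p ≡ q
prime∣prime⇒≡ p-prime q-prime p∣q with prime⇒irreducible q-prime p∣q
... | inj₁ refl = contradiction p-prime ¬prime[1]
... | inj₂ p≡q  = p≡q

prime∧∤⇒coprime : ∀ {p n} → Prime p → p ∤ n → Coprime p n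
prime∧∤⇒coprime p-prime p∤n (d∣p , d∣n) with prime⇒irreducible p-prime d∣p
... | inj₁ d≡1  = d≡1
... | inj₂ refl = contradiction d∣n p∤n

primes-coprime : ∀ {p q} → Prime p → Prime q → p ≢ q → Coprime p q
primes-coprime p-prime q-prime p≢q =
  prime∧∤⇒coprime p-prime (p≢q ∘ prime∣prime⇒≡ p-prime q-prime)

prime∣^⇒∣ : ∀ {p} x n → Prime p → p ∣ x ^ n → p ∣ x
prime∣^⇒∣ x zero    p-prime p∣1 = contradiction (subst Prime (∣1⇒≡1 p∣1) p-prime) ¬prime[1]
prime∣^⇒∣ x (suc n) p-prime p∣x^1+n with euclidsLemma x (x ^ n) p-prime p∣x^1+n
... | inj₁ p∣x   = p∣x
... | inj₂ p∣x^n = prime∣^⇒∣ x n p-prime p∣x^n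

coprime-^ˡ : ∀ {m n} k → Coprime m n → Coprime (m ^ k) n
coprime-^ˡ zero    m⊥n (d∣1 , _) = ∣1⇒≡1 d∣1
coprime-^ˡ {m} {n} (suc k) m⊥n {d} (d∣m^1+k , d∣n) =
  coprime-^ˡ k m⊥n (coprime-divisor {o = m ^ k} d⊥m d∣m^1+k , d∣n)
  where
  d⊥m : Coprime d m
  d⊥m (e∣d , e∣m) = m⊥n (e∣m , ∣-trans e∣d d∣n)

coprime-∣* : ∀ {m n o} → Coprime m n → m ∣ o → n ∣ o → m * n ∣ o
coprime-∣* {m} {n} m⊥n (divides c refl) n∣c*m =
  subst (m * n ∣_) (*-comm m c)
    (*-monoʳ-∣ m (coprime-divisor (Coprime.sym m⊥n) (subst (n ∣_) (*-comm c m) n∣c*m)))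

≡mod⇒∣ : ∀ {n} .⦃ _ : NonZero n ⦄ a b → a % n ≡ (a + b) % n → n ∣ b
≡mod⇒∣ {n} a b eq = ∣m+n∣m⇒∣n (divides ((a + b) div n) (+-cancelˡ-≡ (a % n) _ _ (begin
  a % n + (a div n * n + b)           ≡⟨ +-assoc (a % n) (a div n * n) b ⟨
  (a % n + a div n * n) + b           ≡⟨ cong (_+ b) (m≡m%n+[m/n]*n a n) ⟨
  a + b                             ≡⟨ m≡m%n+[m/n]*n (a + b) n ⟩
  (a + b) % n + (a + b) div n * n     ≡⟨ cong (_+ (a + b) div n * n) eq ⟨
  a % n + (a + b) div n * n           ∎))) (n∣m*n (a div n))
  where open ≡-Reasoning

-- If x ≢ 1 then 1, x, …, x^(p-1) would be p distinct nonzero residues modulo p.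
^p≡1mod⇒≡1mod : ∀ {p} x → Prime p → x ^ p ≡1mod p → x ≡1mod p
^p≡1mod⇒≡1mod {suc (suc _)} zero p-prime (_ , ())
^p≡1mod⇒≡1mod {p@(suc (suc k))} x@(suc _) p-prime x^p≡1 =
  let i , j , i<j , eq = Fin.pigeonhole (n<1+n (suc k)) residue
  in collision (toℕ i) (toℕ j) i<j (Fin.toℕ<n j)
       (trans (sym (Fin.toℕ-fromℕ< _))
         (trans (cong toℕ (Fin.punchOut-injective (nonzero i) (nonzero j) eq)) (Fin.toℕ-fromℕ< _)))
  where
  p∤x^ : ∀ i → p ∤ x ^ i
  p∤x^ i p∣x^i = case ∣∧≡1mod⇒≡1 (∣m⇒∣m*n (x ^ suc k) (prime∣^⇒∣ x i p-prime p∣x^i)) x^p≡1 of λ ()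

  nonzero : ∀ (i : Fin p) → Fin.zero ≢ (x ^ toℕ i) mod p
  nonzero i 0≡x^i = p∤x^ (toℕ i) (m%n≡0⇒n∣m _ p (sym (trans (cong toℕ 0≡x^i) (Fin.toℕ-fromℕ< _))))

  residue : Fin p → Fin (suc k)
  residue i = Fin.punchOut (nonzero i)

  collision : ∀ i j → i < j → j < p → x ^ i % p ≡ x ^ j % p → x ≡1mod p
  -- Two equal residues give `x ^ d ≡ 1` with `0 < d < p`. Together with `x ^ p ≡ 1` this passes to
  -- the exponent `gcd p d`, which is 1.
  collision i j i<j j<p eq = subst (_≡1mod p) (*-identityʳ x)
    (subst (λ e → x ^ e ≡1mod p) (coprime⇒gcd≡1 p⊥d) (≡1mod-gcd p d x^p≡1 x^d≡1))
    where
    d w : ℕ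
    d = j ∸ i
    w = pred (x ^ d)

    1+w≡x^d : suc w ≡ x ^ d
    1+w≡x^d = suc-pred (x ^ d) ⦃ m^n≢0 x d ⦄

    x^j≡ : x ^ j ≡ x ^ i + x ^ i * w
    x^j≡ = begin
      x ^ j             ≡⟨ cong (x ^_) (m+[n∸m]≡n (<⇒≤ i<j)) ⟨
      x ^ (i + d)       ≡⟨ ^-distribˡ-+-* x i d ⟩
      x ^ i * x ^ d     ≡⟨ cong (x ^ i *_) 1+w≡x^d ⟨
      x ^ i * suc w     ≡⟨ *-suc (x ^ i) w ⟩
      x ^ i + x ^ i * w ∎
      where open ≡-Reasoning

    p∣w : p ∣ w
    p∣w with euclidsLemma (x ^ i) w p-prime (≡mod⇒∣ (x ^ i) _ (trans eq (cong (_% p) x^j≡)))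
    ... | inj₁ p∣x^i = contradiction p∣x^i (p∤x^ i)
    ... | inj₂ p∣w   = p∣w

    x^d≡1 : x ^ d ≡1mod p
    x^d≡1 = subst (_≡1mod p) 1+w≡x^d (∣⇒≡1mod p∣w)

    p⊥d : Coprime p d
    p⊥d = Coprime.prime⇒coprime p-prime ⦃ >-nonZero (m<n⇒0<n∸m i<j) ⦄ (≤-<-trans (m∸n≤m j i) j<p)

-- Primitive prime divisors of q^(ps) - 1

-- If `p` divides the sum, then `x ^ p` and hence `x` is 1 modulo `p`. As `p` is odd, it divides
-- `triangular p`, and the second-order expansion shows the sum to be `p` modulo `p * p`.
p²∤geom : ∀ {p} x → Prime p → 3 ≤ p → p * p ∤ geom p x
p²∤geom {suc p} zero p-prime 3≤p p²∣ = contradiction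
  (subst Prime (m*n≡1⇒m≡1 (suc p) (suc p) (∣1⇒≡1 p²∣)) p-prime) ¬prime[1]
p²∤geom {p} (suc x) p-prime 3≤p p²∣ with ^p≡1mod⇒≡1mod (suc x) p-prime (∣geom⇒^≡1mod x p (m*n∣⇒m∣ p p p²∣))
... | k , eq with geom-second-order p (k * p)
...   | w , geom≡ with euclidsLemma 2 (triangular p) p-prime
                     (∣m+n∣m⇒∣n (subst (p ∣_) (trans (sym (2*triangular p)) (+-comm _ p)) (m∣m*n p)) ∣-refl)
...     | inj₁ p∣2 = contradiction (∣⇒≤ p∣2) (<⇒≱ 3≤p)
...     | inj₂ (divides c T≡) = contradiction (∣⇒≤ ⦃ prime⇒nonZero p-prime ⦄ p²∣p)
            (<⇒≱ (m<m*n p p ⦃ prime⇒nonZero p-prime ⦄ (prime≥2 p-prime)))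
  where
  expand : ∀ p k c w → p + k * p * (c * p) + k * p * (k * p) * w ≡ (k * c + k * k * w) * (p * p) + p
  expand = solve-∀
  p²∣p : p * p ∣ p
  p²∣p = ∣m+n∣m⇒∣n
    (subst (p * p ∣_)
      (trans (cong (geom p) eq) (trans geom≡ (trans (cong (λ T → p + k * p * T + k * p * (k * p) * w) T≡) (expand p k c w)))) p²∣)
    (n∣m*n (k * c + k * k * w))

strip-simple : ∀ {p n} → Prime p → p * p ∤ n → ∃[ m ] m ∣ n × p ∤ m × n ≤ p * m
strip-simple {p} {n} p-prime p²∤n with p ∣? n
... | no  p∤n = n , ∣-refl , p∤n , m≤n*m n p ⦃ prime⇒nonZero p-prime ⦄
... | yes (divides m refl) = m , m∣m*n p , (λ p∣m → p²∤n (*-monoˡ-∣ p p∣m)) , ≤-reflexive (*-comm m p)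

-- Removing from `n` the at most simple factors `p` and `s` leaves more than 1, because `n` exceeds
-- `p * s`.
primeDivisor-≢ : ∀ {p s n} → Prime p → Prime s → p * s < n → p * p ∤ n → s * s ∤ n →
                 ∃[ ℓ ] Prime ℓ × ℓ ∣ n × ℓ ≢ p × ℓ ≢ s
primeDivisor-≢ {p} {s} {n} p-prime s-prime ps<n p²∤n s²∤n
  with strip-simple p-prime p²∤n
... | m , m∣n , p∤m , n≤pm with strip-simple s-prime (λ s²∣m → s²∤n (∣-trans s²∣m m∣n))
...   | o , o∣m , s∤o , m≤so with primeDivisor 1<o
  where
  open ≤-Reasoning
  ps<pso : p * s * 1 < p * s * o
  ps<pso = begin-strict
    p * s * 1   ≡⟨ *-identityʳ (p * s) ⟩
    p * s       <⟨ ps<n ⟩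
    n           ≤⟨ n≤pm ⟩
    p * m       ≤⟨ *-monoʳ-≤ p m≤so ⟩
    p * (s * o) ≡⟨ *-assoc p s o ⟨
    p * s * o   ∎
  1<o : 1 < o
  1<o = *-cancelˡ-< (p * s) 1 o ps<pso
...     | ℓ , ℓ-prime , ℓ∣o = ℓ , ℓ-prime , ∣-trans (∣-trans ℓ∣o o∣m) m∣n ,
  (λ { refl → p∤m (∣-trans ℓ∣o o∣m) }) , (λ { refl → s∤o ℓ∣o })

-- Modulo a common divisor `d`, the powers of `suc x` with exponents `p` and `s` are 1, hence so is
-- `suc x`. Both sums then reduce to their numbers of terms, and `d` divides `p` and `s`.
geom-coprime : ∀ {p s} x → Coprime p s → Coprime (geom p (suc x)) (geom s (suc x))
geom-coprime {p} {s} x p⊥s {d} (d∣p , d∣s) = p⊥s (geom-≡1mod p x≡1 d∣p , geom-≡1mod s x≡1 d∣s)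
  where
  x≡1 : suc x ≡1mod d
  x≡1 = subst (_≡1mod d) (*-identityʳ (suc x))
    (subst (λ e → suc x ^ e ≡1mod d) (coprime⇒gcd≡1 p⊥s)
      (≡1mod-gcd p s (∣geom⇒^≡1mod x p d∣p) (∣geom⇒^≡1mod x s d∣s)))

2n+7≤9*3^n : ∀ n → 2 * n + 7 ≤ 3 ^ (2 + n)
2n+7≤9*3^n zero    = m≤m+n 7 2
2n+7≤9*3^n (suc n) = begin
  2 * suc n + 7                 ≡⟨ eq n ⟩
  (2 * n + 7) + 2               ≤⟨ +-mono-≤ ih (≤-trans (≤-trans (m≤m+n 2 5) (m≤n+m 7 (2 * n))) (≤-trans ih (m≤m+n _ _))) ⟩
  3 ^ (3 + n)                   ∎
  where
  open ≤-Reasoning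
  ih : 2 * n + 7 ≤ 3 ^ (2 + n)
  ih = 2n+7≤9*3^n n
  eq : ∀ n → 2 * suc n + 7 ≡ (2 * n + 7) + 2
  eq = solve-∀

-- The quotient is the value at q of the cyclotomic polynomial of index p s.
cyclotomic-quotient : ∀ {p s q c} → 3 ≤ p → 3 ≤ s → 3 ≤ q →
                      geom p (q ^ s) ≡ geom p q * c → p * s < c
cyclotomic-quotient {q = q} {c} (s≤s (s≤s (s≤s {n = i} z≤n))) (s≤s (s≤s (s≤s {n = j} z≤n))) 3≤q eq =
  *-cancelˡ-< (geom p q) (p * s) c (begin-strict
  geom p q * (p * s)        ≤⟨ *-monoʳ-≤ (geom p q) ps≤ ⟩
  geom p q * q ^ e          <⟨ *-monoˡ-< (q ^ e) ⦃ m^n≢0 q e ⦃ >-nonZero (<-trans z<s 3≤q) ⦄ ⦄ (geom<^ p (<⇒≤ 3≤q)) ⟩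
  q ^ p * q ^ e             ≡⟨ ^-distribˡ-+-* q p e ⟨
  q ^ (p + e)               ≡⟨ cong (q ^_) (p+e≡ i j) ⟩
  q ^ (s * (2 + i))         ≡⟨ ^-*-assoc q s (2 + i) ⟨
  (q ^ s) ^ (2 + i)            ≤⟨ ^≤geom (2 + i) (q ^ s) ⟩
  geom p (q ^ s)            ≡⟨ eq ⟩
  geom p q * c              ∎)
  where
  open ≤-Reasoning
  p s n e : ℕ
  p = 3 + i
  s = 3 + j
  -- Chosen so that `e` is `s * (p - 1) - p` without subtraction: the leading term of
  -- `geom p (q ^ s)` is then `q ^ (p + e)`.
  n = 1 + 2 * i + 2 * j + i * j
  e = 2 + n
  p+e≡ : ∀ i j → 3 + i + (3 + 2 * i + 2 * j + i * j) ≡ (3 + j) * (2 + i)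
  p+e≡ = solve-∀
  expand : ∀ i j → (3 + i) * (3 + j) + (i + j + i * j) ≡ 2 * (1 + 2 * i + 2 * j + i * j) + 7
  expand = solve-∀
  ps≤ : p * s ≤ q ^ e
  ps≤ = begin
    p * s                     ≤⟨ m≤m+n (p * s) (i + j + i * j) ⟩
    p * s + (i + j + i * j)   ≡⟨ expand i j ⟩
    2 * n + 7                 ≤⟨ 2n+7≤9*3^n n ⟩
    3 ^ e                     ≤⟨ ^-monoˡ-≤ e 3≤q ⟩
    q ^ e                     ∎

geom>0 : ∀ {n} x → 0 < n → 0 < geom n x
geom>0 {suc n} x _ = z<s

-- The two congruence fields together say that `q` has multiplicative order exactly `d` modulo `ℓ`.
record PrimitivePrime (q d : ℕ) : Set where
  field
    ℓ       : ℕ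
    ℓ-prime : Prime ℓ
    q^d≡1   : q ^ d ≡1mod ℓ
    order   : ∀ {e} → q ^ e ≡1mod ℓ → d ∣ e

-- Otherwise `gcd (p * s) e` is prime to `p` and so divides `s`. As `q` to this gcd is 1 modulo `ℓ`,
-- so would be `q ^ s`.
prime∣order : ∀ {p s q ℓ} e → Prime p → q ^ (p * s) ≡1mod ℓ → ¬ q ^ s ≡1mod ℓ → q ^ e ≡1mod ℓ → p ∣ e
prime∣order {p} {s} {q} {ℓ} e p-prime q^ps≡1 q^s≢1 q^e≡1 with p ∣? e
... | yes p∣e = p∣e
... | no  p∤e with coprime-divisor g⊥p (gcd[m,n]∣m (p * s) e)
  where
  g⊥p : Coprime (gcd (p * s) e) p
  g⊥p (d∣g , d∣p) = prime∧∤⇒coprime p-prime p∤e (d∣p , ∣-trans d∣g (gcd[m,n]∣n (p * s) e))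
...   | divides k eq = contradiction
  (subst (λ n → q ^ n ≡1mod ℓ) (trans (*-comm _ k) (sym eq)) (≡1mod-^* (gcd (p * s) e) k (≡1mod-gcd (p * s) e q^ps≡1 q^e≡1)))
  q^s≢1

-- A case of the Bang-Zsigmondy theorem. The cyclotomic value `c` exceeds `p * s` and is divisible
-- by neither `p * p` nor `s * s`, so it has a prime divisor `ℓ` other than `p` and `s`. If `q ^ p`
-- were 1 modulo `ℓ`, then `geom s (q ^ p)` would be `s` modulo `ℓ` and force `ℓ ≡ s`; likewise for
-- `q ^ s`.
primitivePrime : ∀ {p s q} → Prime p → Prime s → p ≢ s → 3 ≤ p → 3 ≤ s → 3 ≤ q → PrimitivePrime q (p * s)
primitivePrime {p} {s} {q@(suc q′)} p-prime s-prime p≢s 3≤p 3≤s 3≤q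
  -- `geom s q` divides `geom p q * geom s (q ^ p)` and is prime to the first factor; `c` is its
  -- cofactor in the second.
  with coprime-divisor (geom-coprime q′ (primes-coprime s-prime p-prime (p≢s ∘ sym)))
         (subst (geom s q ∣_) geom-swap (m∣m*n (geom p (q ^ s))))
  where
  geom-swap : geom s q * geom p (q ^ s) ≡ geom p q * geom s (q ^ p)
  geom-swap = trans (sym (geom-* s p q)) (trans (cong (λ n → geom n q) (*-comm s p)) (geom-* p s q))
... | divides c geom-s≡ = build (primeDivisor-≢ p-prime s-prime (cyclotomic-quotient 3≤p 3≤s 3≤q geom-p≡)
    (λ p²∣c → p²∤geom (q ^ s) p-prime 3≤p (∣-trans p²∣c c∣geom-p))
    (λ s²∣c → p²∤geom (q ^ p) s-prime 3≤s (∣-trans s²∣c c∣geom-s)))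
  where
  geom-p≡ : geom p (q ^ s) ≡ geom p q * c
  geom-p≡ = *-cancelˡ-≡ _ _ (geom s q) ⦃ >-nonZero (geom>0 q (<-trans z<s 3≤s)) ⦄ (begin
    geom s q * geom p (q ^ s) ≡⟨ geom-* s p q ⟨
    geom (s * p) q            ≡⟨ cong (λ n → geom n q) (*-comm s p) ⟩
    geom (p * s) q            ≡⟨ geom-* p s q ⟩
    geom p q * geom s (q ^ p) ≡⟨ cong (geom p q *_) geom-s≡ ⟩
    geom p q * (c * geom s q) ≡⟨ rotate (geom p q) c (geom s q) ⟩
    geom s q * (geom p q * c) ∎)
    where
    open ≡-Reasoning
    rotate : ∀ a b c → a * (b * c) ≡ c * (a * b)
    rotate = solve-∀

  c∣geom-p : c ∣ geom p (q ^ s)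
  c∣geom-p = subst (c ∣_) (sym geom-p≡) (n∣m*n (geom p q))

  c∣geom-s : c ∣ geom s (q ^ p)
  c∣geom-s = subst (c ∣_) (sym geom-s≡) (m∣m*n (geom s q))

  build : ∃[ ℓ ] Prime ℓ × ℓ ∣ c × ℓ ≢ p × ℓ ≢ s → PrimitivePrime q (p * s)
  build (ℓ , ℓ-prime , ℓ∣c , ℓ≢p , ℓ≢s) = record
    { ℓ-prime = ℓ-prime ; q^d≡1 = q^ps≡1
    ; order = λ {e} q^e≡1 → coprime-∣* (primes-coprime p-prime s-prime p≢s)
        (prime∣order {p} {s} e p-prime q^ps≡1 q^s≢1 q^e≡1)
        (prime∣order {s} {p} e s-prime (subst (λ n → q ^ n ≡1mod ℓ) (*-comm p s) q^ps≡1) q^p≢1 q^e≡1) }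
    where
    q^ps≡1 : q ^ (p * s) ≡1mod ℓ
    q^ps≡1 = ∣geom⇒^≡1mod q′ (p * s)
      (subst (ℓ ∣_) (sym (geom-* p s q)) (∣n⇒∣m*n (geom p q) (∣-trans ℓ∣c c∣geom-s)))
    q^p≢1 : ¬ q ^ p ≡1mod ℓ
    q^p≢1 q^p≡1 = ℓ≢s (prime∣prime⇒≡ ℓ-prime s-prime (geom-≡1mod s q^p≡1 (∣-trans ℓ∣c c∣geom-s)))
    q^s≢1 : ¬ q ^ s ≡1mod ℓ
    q^s≢1 q^s≡1 = ℓ≢p (prime∣prime⇒≡ ℓ-prime p-prime (geom-≡1mod p q^s≡1 (∣-trans ℓ∣c c∣geom-p)))

-- Factored numbers: a list of pairs (p , e) stands for the product of the p ^ e

∏ : {A : Set} → (A → ℕ) → List A → ℕ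
∏ f xs = product (map f xs)

∏-↭ : ∀ {A : Set} (f : A → ℕ) {xs ys} → xs ↭ ys → ∏ f xs ≡ ∏ f ys
∏-↭ f xs↭ys = product-↭ (↭-map f xs↭ys)

prime∤∏ : ∀ {A : Set} {f : A → ℕ} {p xs} → Prime p → All (λ x → p ∤ f x) xs → p ∤ ∏ f xs
prime∤∏ p-prime []       p∣1 = contradiction (subst Prime (∣1⇒≡1 p∣1) p-prime) ¬prime[1]
prime∤∏ p-prime (p∤ ∷ ps∤) p∣ = [ p∤ , prime∤∏ p-prime ps∤ ]′ (euclidsLemma _ _ p-prime p∣)

Component : Set
Component = ℕ × ℕ

-- For (p , e) these are p, p^e, σ(p^e) and p - 1. The last is the totient of the prime, not of its
-- power: `base / totient` is the limit of σ(p^e) / p^e for growing e.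
base value sigma totient : Component → ℕ
base    c = proj₁ c
value   c = proj₁ c ^ proj₂ c
sigma   c = geom (suc (proj₂ c)) (proj₁ c)
totient c = pred (proj₁ c)

record Odd (c : Component) : Set where
  constructor odd
  field
    3≤base     : 3 ≤ base c
    2∤base     : 2 ∤ base c
    1≤exponent : 1 ≤ proj₂ c

open Odd

sigma-totient : ∀ c → 1 ≤ base c → 1 + sigma c * totient c ≡ value c * base c
sigma-totient (suc r , e) _ = begin
  1 + geom (suc e) (suc r) * r ≡⟨ cong suc (*-comm (geom (suc e) (suc r)) r) ⟩
  1 + r * geom (suc e) (suc r) ≡⟨ ^-geom r (suc e) ⟨
  suc r * suc r ^ e            ≡⟨ *-comm (suc r) (suc r ^ e) ⟩
  suc r ^ e * suc r            ∎
  where open ≡-Reasoning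

1≤base : ∀ {c} → Odd c → 1 ≤ base c
1≤base c-odd = ≤-trans (s≤s z≤n) (3≤base c-odd)

value<sigma : ∀ {c} → Odd c → value c < sigma c
value<sigma {p , suc e} c-odd = begin-strict
  p ^ suc e                  <⟨ m<m+n (p ^ suc e) z<s ⟩
  p ^ suc e + geom (suc e) p ≡⟨ geom-snoc (suc e) p ⟨
  geom (2 + e) p             ∎
  where open ≤-Reasoning
value<sigma {p , zero} (odd _ _ ())

value≤sigma : ∀ {cs} → All Odd cs → ∏ value cs ≤ ∏ sigma cs
value≤sigma []             = ≤-refl
value≤sigma (c-odd ∷ odds) = *-mono-≤ (<⇒≤ (value<sigma c-odd)) (value≤sigma odds)

value>0 : ∀ {cs} → All Odd cs → 0 < ∏ value cs
value>0 []             = z<s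
value>0 {c ∷ _} (c-odd ∷ odds) = *-mono-≤ (m^n>0 (base c) ⦃ >-nonZero (1≤base c-odd) ⦄ (proj₂ c)) (value>0 odds)

sigma>0 : ∀ {cs} → All Odd cs → 0 < ∏ sigma cs
sigma>0 odds = ≤-trans (value>0 odds) (value≤sigma odds)

-- Cross-multiplied product of the bounds σ(p^e) / p^e < p / (p - 1).
sigma-totient≤ : ∀ {cs} → All Odd cs → ∏ sigma cs * ∏ totient cs ≤ ∏ value cs * ∏ base cs
sigma-totient≤ []                           = ≤-refl
sigma-totient≤ {c ∷ cs} (c-odd ∷ odds) = begin
  sigma c * ∏ sigma cs * (totient c * ∏ totient cs)   ≡⟨ [m*n]*[o*p]≡[m*o]*[n*p] (sigma c) (∏ sigma cs) (totient c) _ ⟩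
  sigma c * totient c * (∏ sigma cs * ∏ totient cs)   ≤⟨ *-mono-≤ (≤-trans (n≤1+n _) (≤-reflexive (sigma-totient c (1≤base c-odd)))) (sigma-totient≤ odds) ⟩
  value c * base c * (∏ value cs * ∏ base cs)         ≡⟨ [m*n]*[o*p]≡[m*o]*[n*p] (value c) (base c) (∏ value cs) _ ⟩
  value c * ∏ value cs * (base c * ∏ base cs)         ∎
  where open ≤-Reasoning

-- σ(p^e) is p^e plus `geom e p`, and `geom e p * (p - 1)` is less than p^e; here `w` is at most
-- `p - 1`.
sigma*≤value*suc : ∀ {c w} → Odd c → w < base c → sigma c * w ≤ value c * suc w
sigma*≤value*suc {suc r , e} {w} c-odd (s≤s w≤r) = begin
  geom (suc e) (suc r) * w                     ≡⟨ cong (_* w) (geom-snoc e (suc r)) ⟩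
  (suc r ^ e + geom e (suc r)) * w             ≡⟨ *-distribʳ-+ w (suc r ^ e) _ ⟩
  suc r ^ e * w + geom e (suc r) * w           ≤⟨ +-monoʳ-≤ (suc r ^ e * w) (*-monoʳ-≤ (geom e (suc r)) w≤r) ⟩
  suc r ^ e * w + geom e (suc r) * r           ≡⟨ cong (suc r ^ e * w +_) (*-comm _ r) ⟩
  suc r ^ e * w + r * geom e (suc r)           ≤⟨ +-monoʳ-≤ (suc r ^ e * w) (≤-trans (n≤1+n _) (≤-reflexive (sym (^-geom r e)))) ⟩
  suc r ^ e * w + suc r ^ e                    ≡⟨ +-comm (suc r ^ e * w) _ ⟩
  suc r ^ e + suc r ^ e * w                    ≡⟨ *-suc (suc r ^ e) w ⟨
  suc r ^ e * suc w                            ∎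
  where open ≤-Reasoning

-- Each σ(p^e) / p^e is at most `(w + 1) / w`, with `w` running upwards from `t` along the list, so
-- the product telescopes.
sigma-large-bases : ∀ t {cs} → All Odd cs → All (λ c → t + length cs < base c) cs →
                    ∏ sigma cs * t ≤ ∏ value cs * (t + length cs)
sigma-large-bases t [] [] = ≤-reflexive (cong (1 *_) (sym (+-identityʳ t)))
sigma-large-bases t {c ∷ cs} (c-odd ∷ odds) (large ∷ larges) = begin
  sigma c * ∏ sigma cs * t              ≡⟨ *-assoc (sigma c) (∏ sigma cs) t ⟩
  sigma c * (∏ sigma cs * t)            ≤⟨ *-monoʳ-≤ (sigma c) (sigma-large-bases t odds (All.map (≤-trans (s≤s (+-monoʳ-≤ t (n≤1+n (length cs))))) larges)) ⟩
  sigma c * (∏ value cs * w)            ≡⟨ rotate (sigma c) (∏ value cs) w ⟩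
  sigma c * w * ∏ value cs              ≤⟨ *-monoˡ-≤ (∏ value cs) (sigma*≤value*suc c-odd (≤-<-trans (+-monoʳ-≤ t (n≤1+n (length cs))) large)) ⟩
  value c * suc w * ∏ value cs          ≡⟨ rotate (value c) (∏ value cs) (suc w) ⟨
  value c * (∏ value cs * suc w)        ≡⟨ *-assoc (value c) (∏ value cs) (suc w) ⟨
  value c * ∏ value cs * suc w          ≡⟨ cong (value c * ∏ value cs *_) (+-suc t (length cs)) ⟨
  value c * ∏ value cs * (t + suc (length cs)) ∎
  where
  open ≤-Reasoning
  w : ℕ
  w = t + length cs
  rotate : ∀ a b c → a * (b * c) ≡ a * c * b
  rotate = solve-∀

-- With v = p^(e+1) one has σ(p^e)(p - 1) = v - 1, and v / (v - 1) is at most `(w + 1) / w` for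
-- `w < v`.
value*base*≤ : ∀ {c w} → Odd c → w < value c * base c →
               value c * base c * w ≤ sigma c * totient c * suc w
value*base*≤ {c} {w} c-odd w<vb = begin
  value c * base c * w  ≡⟨ cong (_* w) (sigma-totient c (1≤base c-odd)) ⟨
  suc st * w            ≡⟨⟩
  w + st * w            ≤⟨ +-monoˡ-≤ (st * w) (s≤s⁻¹ (≤-trans w<vb (≤-reflexive (sym (sigma-totient c (1≤base c-odd)))))) ⟩
  st + st * w           ≡⟨ *-suc st w ⟨
  st * suc w            ∎
  where
  open ≤-Reasoning
  st : ℕ
  st = sigma c * totient c

-- Bounds how far σ(B) / B lies below its limit, by the same telescoping product.
sigma-large-values : ∀ t {cs} → All Odd cs → All (λ c → t + length cs < value c * base c) cs →
                     ∏ value cs * ∏ base cs * t ≤ ∏ sigma cs * ∏ totient cs * (t + length cs)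
sigma-large-values t [] [] = ≤-reflexive (cong (1 *_) (sym (+-identityʳ t)))
sigma-large-values t {c ∷ cs} (c-odd ∷ odds) (large ∷ larges) = begin
  value c * ∏ value cs * (base c * ∏ base cs) * t          ≡⟨ regroup (value c) (∏ value cs) (base c) (∏ base cs) t ⟩
  value c * base c * (∏ value cs * ∏ base cs * t)          ≤⟨ *-monoʳ-≤ (value c * base c) (sigma-large-values t odds (All.map (≤-trans (s≤s (+-monoʳ-≤ t (n≤1+n (length cs))))) larges)) ⟩
  value c * base c * (∏ sigma cs * ∏ totient cs * w)       ≡⟨ rotate (value c * base c) _ w ⟩
  value c * base c * w * (∏ sigma cs * ∏ totient cs)       ≤⟨ *-monoˡ-≤ (∏ sigma cs * ∏ totient cs) (value*base*≤ c-odd (≤-<-trans (+-monoʳ-≤ t (n≤1+n (length cs))) large)) ⟩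
  sigma c * totient c * suc w * (∏ sigma cs * ∏ totient cs) ≡⟨ rotate (sigma c * totient c) _ (suc w) ⟨
  sigma c * totient c * (∏ sigma cs * ∏ totient cs * suc w) ≡⟨ regroup (sigma c) (∏ sigma cs) (totient c) (∏ totient cs) (suc w) ⟨
  sigma c * ∏ sigma cs * (totient c * ∏ totient cs) * suc w ≡⟨ cong (sigma c * ∏ sigma cs * (totient c * ∏ totient cs) *_) (+-suc t (length cs)) ⟨
  sigma c * ∏ sigma cs * (totient c * ∏ totient cs) * (t + suc (length cs)) ∎
  where
  open ≤-Reasoning
  w : ℕ
  w = t + length cs
  rotate : ∀ a b c → a * (b * c) ≡ a * c * b
  rotate = solve-∀
  regroup : ∀ a b c d t → a * b * (c * d) * t ≡ a * c * (b * d * t)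
  regroup = solve-∀

all⊎pick : ∀ {A : Set} {P : A → Set} → (∀ x → Dec (P x)) → ∀ xs →
           All P xs ⊎ (∃₂ λ x ys → xs ↭ x ∷ ys × ¬ P x)
all⊎pick P? [] = inj₁ []
all⊎pick P? (x ∷ xs) with P? x
... | no ¬px = inj₂ (x , xs , ↭-refl , ¬px)
... | yes px with all⊎pick P? xs
...   | inj₁ pxs = inj₁ (px ∷ pxs)
...   | inj₂ (y , ys , xs↭ , ¬py) = inj₂ (y , x ∷ ys , ↭-trans (↭-prep x xs↭) (↭-swap x y ↭-refl) , ¬py)

-- Bounding a perfect number by its number of prime factors

-- `suc (x * k + k)` majorises the threshold up to which a prime or prime power counts as small, so
-- the product bounds the next value of `y`.
grow : ℕ → ℕ → ℕ
grow k x = x * suc (x * k + k)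

y*z≤grow : ∀ {k j x y z} → j ≤ k → y ≤ x → z ≤ suc (y * j) + j → y * z ≤ grow k x
y*z≤grow {k} {j} {x} {y} {z} j≤k y≤x z≤ = *-mono-≤ y≤x (begin
  z                ≤⟨ z≤ ⟩
  suc (y * j + j)  ≤⟨ s≤s (+-mono-≤ (*-mono-≤ y≤x j≤k) j≤k) ⟩
  suc (x * k + k)  ∎)
  where open ≤-Reasoning

iterateStep : (fuel k x : ℕ) → ℕ
iterateStep zero    k x = x
iterateStep (suc f) k x = iterateStep f k (grow k x)

x≤iterateStep : ∀ f k x → x ≤ iterateStep f k x
x≤iterateStep zero    k x = ≤-refl
x≤iterateStep (suc f) k x = ≤-trans (m≤m*n x (suc (x * k + k))) (x≤iterateStep f k (grow k x))

2∣m*2∤n⇒2∣m : ∀ {m n} → 2 ∤ n → 2 ∣ m * n → 2 ∣ m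
2∣m*2∤n⇒2∣m {m} {n} 2∤n 2∣mn = [ id , (λ 2∣n → contradiction 2∣n 2∤n) ]′ (euclidsLemma m n prime[2] 2∣mn)

2∣pred-odd : ∀ {n} → 2 ∤ n → 2 ∣ pred n
2∣pred-odd {zero}        2∤0 = contradiction (divides 0 refl) 2∤0
2∣pred-odd {suc zero}    2∤n = divides 0 refl
2∣pred-odd {suc (suc n)} 2∤n with 2∣pred-odd {n} (λ 2∣n → 2∤n (∣m∣n⇒∣m+n ∣-refl 2∣n))
2∣pred-odd {suc (suc zero)}    2∤n | _   = contradiction ∣-refl 2∤n
2∣pred-odd {suc (suc (suc n))} 2∤n | 2∣n = ∣m∣n⇒∣m+n ∣-refl 2∣n

4∤2*odd : ∀ {n} → 2 ∤ n → 4 ∤ 2 * n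
4∤2*odd 2∤n 4∣2n = 2∤n (*-cancelˡ-∣ 2 4∣2n)

odd-∏ : ∀ {cs} → All Odd cs → 2 ∤ ∏ base cs × 2 ∤ ∏ value cs
odd-∏ odds =
  prime∤∏ {f = base} prime[2] (All.map 2∤base odds) ,
  prime∤∏ {f = value} prime[2] (All.map (λ {c} c-odd → 2∤base c-odd ∘ prime∣^⇒∣ (base c) (proj₂ c) prime[2]) odds)

-- The prime powers exactly dividing N are split into those that are already
-- bounded (as), those whose prime is bounded (bs) and the others (cs), with
-- products A, B and C.  Since N is perfect, z / y is the quotient of σ(BC) / BC
-- by the limit of σ(B) / B for growing exponents.  So z > y forces a small prime
-- in C, z < y a small prime power in B, and z = y contradicts parity.
module _ {as bs cs : List Component} (as-odd : All Odd as) (bs-odd : All Odd bs) (cs-odd : All Odd cs)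
         (perfect : ∏ sigma as * ∏ sigma bs * ∏ sigma cs ≡ 2 * (∏ value as * ∏ value bs * ∏ value cs))
         where
  private
    y z va vb vc sa sb sc rb fb : ℕ
    va = ∏ value as
    vb = ∏ value bs
    vc = ∏ value cs
    sa = ∏ sigma as
    sb = ∏ sigma bs
    sc = ∏ sigma cs
    rb = ∏ base bs
    fb = ∏ totient bs
    y = sa * rb
    z = 2 * va * fb

    instance
      va≢0 : NonZero va
      va≢0 = >-nonZero (value>0 as-odd)
      vb≢0 : NonZero vb
      vb≢0 = >-nonZero (value>0 bs-odd)
      vc≢0 : NonZero vc
      vc≢0 = >-nonZero (value>0 cs-odd)

  -- With B empty, `z ≡ y` says σ(A) = 2A, so that σ(C) = C for a nonempty C. Otherwise some p - 1
  -- makes 4 divide `z`, hence `sa * rb`, hence `sa` as `rb` is odd; but σ(N) is twice an odd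
  -- number.
  balanced-impossible : 0 < length bs + length cs → z ≢ y
  balanced-impossible nonempty z≡y = go bs cs bs-odd cs-odd nonempty perfect z≡y
    where
    go : ∀ bs cs → All Odd bs → All Odd cs → 0 < length bs + length cs →
         sa * ∏ sigma bs * ∏ sigma cs ≡ 2 * (va * ∏ value bs * ∏ value cs) →
         2 * va * ∏ totient bs ≢ sa * ∏ base bs
    go [] (c ∷ cs) _ (c-odd ∷ cs-odd) _ perfect z≡y = <-irrefl
      (*-cancelˡ-≡ _ _ (2 * va) ⦃ m*n≢0 2 va ⦄ (begin-equality
        2 * va * ∏ value (c ∷ cs)        ≡⟨ eq va (∏ value (c ∷ cs)) ⟩
        2 * (va * 1 * ∏ value (c ∷ cs))  ≡⟨ perfect ⟨
        sa * 1 * ∏ sigma (c ∷ cs)        ≡⟨ cong (_* ∏ sigma (c ∷ cs)) z≡y ⟨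
        2 * va * 1 * ∏ sigma (c ∷ cs)    ≡⟨ cong (_* ∏ sigma (c ∷ cs)) (*-identityʳ (2 * va)) ⟩
        2 * va * ∏ sigma (c ∷ cs)        ∎))
      (<-≤-trans (*-monoˡ-< (∏ value cs) ⦃ >-nonZero (value>0 cs-odd) ⦄ (value<sigma c-odd)) (*-monoʳ-≤ (sigma c) (value≤sigma cs-odd)))
      where
      open ≤-Reasoning
      eq : ∀ a c → 2 * a * c ≡ 2 * (a * 1 * c)
      eq = solve-∀
    go bs@(b ∷ bs′) cs odds@(b-odd ∷ _) cs-odd _ perfect z≡y =
      4∤2*odd 2∤V (subst (4 ∣_) perfect (∣m⇒∣m*n (∏ sigma cs) (∣m⇒∣m*n (∏ sigma bs) 4∣sa)))
      where
      2∤V : 2 ∤ va * ∏ value bs * ∏ value cs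
      2∤V 2∣V = proj₂ (odd-∏ as-odd) (2∣m*2∤n⇒2∣m (proj₂ (odd-∏ odds)) (2∣m*2∤n⇒2∣m (proj₂ (odd-∏ cs-odd)) 2∣V))

      4∣z : 4 ∣ 2 * va * ∏ totient bs
      4∣z = *-pres-∣ {2} {2 * va} {2} (m∣m*n va) (∣m⇒∣m*n (∏ totient bs′) (2∣pred-odd (2∤base b-odd)))

      4∣sa : 4 ∣ sa
      4∣sa = coprime-divisor {n = ∏ base bs} (coprime-^ˡ 2 (prime∧∤⇒coprime prime[2] (proj₁ (odd-∏ odds))))
        (subst (4 ∣_) (trans z≡y (*-comm sa _)) 4∣z)

  -- By perfection σ(C) / C is `2 * va * vb / (sa * sb)`, and σ(B) / B is at most its limit
  -- `rb / fb`.
  z*vc≤y*sc : z * vc ≤ y * sc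
  z*vc≤y*sc = *-cancelʳ-≤ (z * vc) (y * sc) vb (begin
    2 * va * fb * vc * vb      ≡⟨ eq va fb vc vb ⟩
    2 * (va * vb * vc) * fb    ≡⟨ cong (_* fb) perfect ⟨
    sa * sb * sc * fb          ≡⟨ eq₁ sa sb sc fb ⟩
    sb * fb * (sa * sc)        ≤⟨ *-monoˡ-≤ (sa * sc) (sigma-totient≤ bs-odd) ⟩
    vb * rb * (sa * sc)        ≡⟨ eq₂ vb rb sa sc ⟩
    sa * rb * sc * vb          ∎)
    where
    open ≤-Reasoning
    eq : ∀ a f c b → 2 * a * f * c * b ≡ 2 * (a * b * c) * f
    eq = solve-∀
    eq₁ : ∀ a b c f → a * b * c * f ≡ b * f * (a * c)
    eq₁ = solve-∀
    eq₂ : ∀ b r a c → b * r * (a * c) ≡ a * r * c * b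
    eq₂ = solve-∀

  -- If all primes in C were large, σ(C) / C would be at most `(t + k) / t`. The choice of `t` above
  -- `y * k` makes this smaller than `(y + 1) / y`, which `z / y` reaches.
  some-small-base : y < z → ¬ All (λ c → suc (y * length cs) + length cs < base c) cs
  some-small-base y<z larges = <-irrefl refl (begin-strict
    y * t + t           ≡⟨ +-comm (y * t) t ⟩
    suc y * t           ≤⟨ *-monoˡ-≤ t y<z ⟩
    z * t               ≤⟨ *-cancelˡ-≤ vc (begin
      vc * (z * t)             ≡⟨ eq vc z t ⟩
      z * vc * t               ≤⟨ *-monoˡ-≤ t z*vc≤y*sc ⟩
      y * sc * t               ≡⟨ *-assoc y sc t ⟩
      y * (sc * t)             ≤⟨ *-monoʳ-≤ y (sigma-large-bases t cs-odd larges) ⟩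
      y * (vc * (t + k))       ≡⟨ eq₁ y vc (t + k) ⟩
      vc * (y * (t + k))       ∎) ⟩
    y * (t + k)         ≡⟨ *-distribˡ-+ y t k ⟩
    y * t + y * k       <⟨ +-monoʳ-< (y * t) (n<1+n (y * k)) ⟩
    y * t + t           ∎)
    where
    open ≤-Reasoning
    k t : ℕ
    k = length cs
    t = suc (y * k)
    eq : ∀ a b c → a * (b * c) ≡ b * a * c
    eq = solve-∀
    eq₁ : ∀ a b c → a * (b * c) ≡ b * (a * c)
    eq₁ = solve-∀

  -- If all prime powers in B were large, the shortfall of σ(B) / B from its limit would give
  -- `y * t ≤ z * (t + k)`, using σ(C) ≥ C. This contradicts `z + 1 ≤ y`, since `z * k` is less than
  -- `t`.
  some-small-value : z < y → ¬ All (λ c → suc (y * length bs) + length bs < value c * base c) bs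
  some-small-value z<y larges = <-irrefl refl (begin-strict
    z * t + t           ≡⟨ +-comm (z * t) t ⟩
    suc z * t           ≤⟨ *-monoˡ-≤ t z<y ⟩
    y * t               ≤⟨ *-cancelˡ-≤ (vb * vc) ⦃ m*n≢0 vb vc ⦄ (begin
      vb * vc * (sa * rb * t)         ≡⟨ eq vb vc sa rb t ⟩
      sa * vc * (vb * rb * t)         ≤⟨ *-monoʳ-≤ (sa * vc) (sigma-large-values t bs-odd larges) ⟩
      sa * vc * (sb * fb * (t + k))   ≤⟨ *-monoˡ-≤ (sb * fb * (t + k)) (*-monoʳ-≤ sa (value≤sigma cs-odd)) ⟩
      sa * sc * (sb * fb * (t + k))   ≡⟨ eq₁ sa sc sb fb (t + k) ⟩
      sa * sb * sc * (fb * (t + k))   ≡⟨ cong (_* (fb * (t + k))) perfect ⟩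
      2 * (va * vb * vc) * (fb * (t + k)) ≡⟨ eq₂ va vb vc fb (t + k) ⟩
      vb * vc * (z * (t + k))         ∎) ⟩
    z * (t + k)         ≡⟨ *-distribˡ-+ z t k ⟩
    z * t + z * k       <⟨ +-monoʳ-< (z * t) (s≤s (*-monoˡ-≤ k (<⇒≤ z<y))) ⟩
    z * t + t           ∎)
    where
    open ≤-Reasoning
    k t : ℕ
    k = length bs
    t = suc (y * k)
    eq : ∀ b c a r t → b * c * (a * r * t) ≡ a * c * (b * r * t)
    eq = solve-∀
    eq₁ : ∀ a c b f t → a * c * (b * f * t) ≡ a * b * c * (f * t)
    eq₁ = solve-∀
    eq₂ : ∀ a b c f t → 2 * (a * b * c) * (f * t) ≡ b * c * (2 * a * f * t)
    eq₂ = solve-∀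

-- Each step moves one component from C to B, fixing its prime, or from B to A, fixing its power.
-- Hence `length bs + 2 * length cs` drops by one, and `x` remains a bound for σ(A) times the primes
-- of B. When only A is left, N ≤ σ(A) ≤ `x`.
perfect-bound : ∀ f k x {as bs cs} → All Odd as → All Odd bs → All Odd cs →
  length bs + length cs ≤ k → length bs + 2 * length cs ≤ f → ∏ sigma as * ∏ base bs ≤ x →
  ∏ sigma as * ∏ sigma bs * ∏ sigma cs ≡ 2 * (∏ value as * ∏ value bs * ∏ value cs) →
  ∏ value as * ∏ value bs * ∏ value cs ≤ iterateStep f k x

perfect-bound-nonempty : ∀ f k x {as bs cs} → All Odd as → All Odd bs → All Odd cs →
  0 < length bs + length cs →
  length bs + length cs ≤ k → length bs + 2 * length cs ≤ f → ∏ sigma as * ∏ base bs ≤ x →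
  ∏ sigma as * ∏ sigma bs * ∏ sigma cs ≡ 2 * (∏ value as * ∏ value bs * ∏ value cs) →
  ∏ value as * ∏ value bs * ∏ value cs ≤ iterateStep f k x

perfect-bound f k x {as} {[]} {[]} as-odd bs-odd cs-odd ≤k ≤f ≤x perfect = begin
  ∏ value as * 1 * 1 ≡⟨ *-identityʳ _ ⟩
  ∏ value as * 1     ≤⟨ *-monoˡ-≤ 1 (value≤sigma as-odd) ⟩
  ∏ sigma as * 1     ≤⟨ ≤x ⟩
  x                  ≤⟨ x≤iterateStep f k x ⟩
  iterateStep f k x  ∎
  where open ≤-Reasoning
perfect-bound f k x {bs = _ ∷ _} as-odd bs-odd cs-odd = perfect-bound-nonempty f k x as-odd bs-odd cs-odd z<s
perfect-bound f k x {bs = []} {_ ∷ _} as-odd bs-odd cs-odd = perfect-bound-nonempty f k x as-odd bs-odd cs-odd z<s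

perfect-bound-nonempty zero k x {bs = _ ∷ _} as-odd bs-odd cs-odd nonempty ≤k () ≤x perfect
perfect-bound-nonempty zero k x {bs = []} {_ ∷ _} as-odd bs-odd cs-odd nonempty ≤k () ≤x perfect
perfect-bound-nonempty (suc f) k x {as} {bs} {cs} as-odd bs-odd cs-odd nonempty ≤k ≤f ≤x perfect
  with <-cmp (2 * ∏ value as * ∏ totient bs) (∏ sigma as * ∏ base bs)
... | tri≈ _ z≡y _ = contradiction z≡y (balanced-impossible as-odd bs-odd cs-odd perfect nonempty)
-- The picked component has a small prime and passes from C to B.
... | tri> _ _ y<z with all⊎pick (λ c → suc (∏ sigma as * ∏ base bs * length cs) + length cs <? base c) cs
...   | inj₁ larges = contradiction larges (some-small-base as-odd bs-odd cs-odd perfect y<z)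
...   | inj₂ (c , cs′ , cs↭ , ¬large) with All-resp-↭ cs↭ cs-odd
...     | c-odd ∷ cs′-odd = begin
  va * vb * ∏ value cs             ≡⟨ cong (va * vb *_) (∏-↭ value cs↭) ⟩
  va * vb * (value c * vc′)        ≡⟨ move va vb (value c) vc′ ⟩
  va * (value c * vb) * vc′        ≤⟨ perfect-bound f k (grow k x) as-odd (c-odd ∷ bs-odd) cs′-odd ≤k′ ≤f′ ≤x′ perfect′ ⟩
  iterateStep f k (grow k x)       ∎
  where
  open ≤-Reasoning
  va vb vc′ : ℕ
  va = ∏ value as
  vb = ∏ value bs
  vc′ = ∏ value cs′

  move : ∀ a b c d → a * b * (c * d) ≡ a * (c * b) * d
  move = solve-∀

  ≤k′ : suc (length bs + length cs′) ≤ k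
  ≤k′ = subst (_≤ k) (trans (cong (length bs +_) (↭-length cs↭)) (+-suc (length bs) (length cs′))) ≤k

  ≤f′ : suc (length bs + 2 * length cs′) ≤ f
  ≤f′ = s≤s⁻¹ (subst (_≤ suc f) (trans (cong (λ n → length bs + 2 * n) (↭-length cs↭)) (eq (length bs) (length cs′))) ≤f)
    where
    eq : ∀ b c → b + 2 * suc c ≡ 2 + (b + 2 * c)
    eq = solve-∀

  ≤x′ : ∏ sigma as * (base c * ∏ base bs) ≤ grow k x
  ≤x′ = begin
    ∏ sigma as * (base c * ∏ base bs) ≡⟨ cong (∏ sigma as *_) (*-comm (base c) _) ⟩
    ∏ sigma as * (∏ base bs * base c) ≡⟨ *-assoc (∏ sigma as) _ _ ⟨
    ∏ sigma as * ∏ base bs * base c   ≤⟨ y*z≤grow (≤-trans (m≤n+m (length cs) (length bs)) ≤k) ≤x (≮⇒≥ ¬large) ⟩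
    grow k x                          ∎

  perfect′ : ∏ sigma as * (sigma c * ∏ sigma bs) * ∏ sigma cs′ ≡ 2 * (va * (value c * vb) * vc′)
  perfect′ = begin-equality
    ∏ sigma as * (sigma c * ∏ sigma bs) * ∏ sigma cs′   ≡⟨ move (∏ sigma as) (∏ sigma bs) (sigma c) _ ⟨
    ∏ sigma as * ∏ sigma bs * (sigma c * ∏ sigma cs′)   ≡⟨ cong (∏ sigma as * ∏ sigma bs *_) (∏-↭ sigma cs↭) ⟨
    ∏ sigma as * ∏ sigma bs * ∏ sigma cs                ≡⟨ perfect ⟩
    2 * (va * vb * ∏ value cs)                          ≡⟨ cong (λ v → 2 * (va * vb * v)) (∏-↭ value cs↭) ⟩
    2 * (va * vb * (value c * vc′))                     ≡⟨ cong (2 *_) (move va vb (value c) vc′) ⟩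
    2 * (va * (value c * vb) * vc′)                     ∎
-- The picked component has a small p^(e+1) and passes from B to A.
perfect-bound-nonempty (suc f) k x {as} {bs} {cs} as-odd bs-odd cs-odd nonempty ≤k ≤f ≤x perfect
    | tri< z<y _ _ with all⊎pick (λ c → suc (∏ sigma as * ∏ base bs * length bs) + length bs <? value c * base c) bs
...   | inj₁ larges = contradiction larges (some-small-value as-odd bs-odd cs-odd perfect z<y)
...   | inj₂ (c , bs′ , bs↭ , ¬large) with All-resp-↭ bs↭ bs-odd
...     | c-odd ∷ bs′-odd = begin
  va * ∏ value bs * vc             ≡⟨ cong (λ v → va * v * vc) (∏-↭ value bs↭) ⟩
  va * (value c * vb′) * vc        ≡⟨ move va (value c) vb′ vc ⟩
  value c * va * vb′ * vc          ≤⟨ perfect-bound f k (grow k x) (c-odd ∷ as-odd) bs′-odd cs-odd ≤k′ ≤f′ ≤x′ perfect′ ⟩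
  iterateStep f k (grow k x)       ∎
  where
  open ≤-Reasoning
  va vb′ vc : ℕ
  va = ∏ value as
  vb′ = ∏ value bs′
  vc = ∏ value cs

  move : ∀ a b c d → a * (b * c) * d ≡ b * a * c * d
  move = solve-∀

  ≤k′ : length bs′ + length cs ≤ k
  ≤k′ = ≤-trans (n≤1+n _) (subst (_≤ k) (cong (_+ length cs) (↭-length bs↭)) ≤k)

  ≤f′ : length bs′ + 2 * length cs ≤ f
  ≤f′ = s≤s⁻¹ (subst (_≤ suc f) (cong (_+ 2 * length cs) (↭-length bs↭)) ≤f)

  -- σ(p^e) is below p^(e+1), and restoring the factor p to the primes of B only enlarges the
  -- product.
  ≤x′ : sigma c * ∏ sigma as * ∏ base bs′ ≤ grow k x
  ≤x′ = begin
    sigma c * ∏ sigma as * ∏ base bs′                       ≤⟨ *-mono-≤ (*-monoˡ-≤ (∏ sigma as) (≤-trans (<⇒≤ (geom<^ (suc (proj₂ c)) (≤-trans (n≤1+n 2) (3≤base c-odd)))) (≤-reflexive (*-comm (base c) (value c)))))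
                                                                       (m≤n*m (∏ base bs′) (base c) ⦃ >-nonZero (1≤base c-odd) ⦄) ⟩
    value c * base c * ∏ sigma as * (base c * ∏ base bs′)   ≡⟨ rotate (value c * base c) (∏ sigma as) _ ⟩
    ∏ sigma as * (base c * ∏ base bs′) * (value c * base c) ≡⟨ cong (λ r → ∏ sigma as * r * (value c * base c)) (∏-↭ base bs↭) ⟨
    ∏ sigma as * ∏ base bs * (value c * base c)             ≤⟨ y*z≤grow (≤-trans (m≤m+n (length bs) (length cs)) ≤k) ≤x (≮⇒≥ ¬large) ⟩
    grow k x                                                ∎
    where
    rotate : ∀ a b c → a * b * c ≡ b * c * a
    rotate = solve-∀

  perfect′ : sigma c * ∏ sigma as * ∏ sigma bs′ * ∏ sigma cs ≡ 2 * (value c * va * vb′ * vc)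
  perfect′ = begin-equality
    sigma c * ∏ sigma as * ∏ sigma bs′ * ∏ sigma cs     ≡⟨ move (∏ sigma as) (sigma c) (∏ sigma bs′) _ ⟨
    ∏ sigma as * (sigma c * ∏ sigma bs′) * ∏ sigma cs   ≡⟨ cong (λ s → ∏ sigma as * s * ∏ sigma cs) (∏-↭ sigma bs↭) ⟨
    ∏ sigma as * ∏ sigma bs * ∏ sigma cs                ≡⟨ perfect ⟩
    2 * (va * ∏ value bs * vc)                          ≡⟨ cong (λ v → 2 * (va * v * vc)) (∏-↭ value bs↭) ⟩
    2 * (va * (value c * vb′) * vc)                     ≡⟨ cong (2 *_) (move va (value c) vb′ vc) ⟩
    2 * (value c * va * vb′ * vc)                       ∎

-- The sum of divisors of a factored number

divisors : ℕ → List ℕ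
divisors n = filter (_∣? n) (map suc (upTo n))

divisors-unique : ∀ n → Unique (divisors n)
divisors-unique n = filter⁺ (_∣? n) (unique-map suc-injective (upTo⁺ n))

∣⇒∈-divisors : ∀ {d n} → 0 < n → d ∣ n → d ∈ divisors n
∣⇒∈-divisors {zero}      0<n 0∣n = contradiction 0<n (λ 0<n → <-irrefl (sym (0∣⇒≡0 0∣n)) 0<n)
∣⇒∈-divisors {suc d} {n} 0<n d∣n =
  ∈-filter⁺ (_∣? n) (∈-map⁺ suc (∈-upTo⁺ (∣⇒≤ ⦃ >-nonZero 0<n ⦄ d∣n))) d∣n

∈-divisors⇒∣ : ∀ {d} n → d ∈ divisors n → d ∣ n
∈-divisors⇒∣ n d∈ = proj₂ (∈-filter⁻ (_∣? n) {xs = map suc (upTo n)} d∈)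

-- Two duplicate-free lists with the same members are permutations of each other.
σ≡sum : ∀ {n ds} → 0 < n → Unique ds → (∀ {d} → d ∈ ds → d ∣ n) → (∀ {d} → d ∣ n → d ∈ ds) → σ n ≡ sum ds
σ≡sum {n} 0<n ds-unique ∈⇒∣ ∣⇒∈ = sum-↭ (∼bag⇒↭ (unique∧set⇒bag (divisors-unique n) ds-unique
  (mk⇔ (∣⇒∈ ∘ ∈-divisors⇒∣ n) (∣⇒∈-divisors 0<n ∘ ∈⇒∣))))

sum-map-* : ∀ k ns → sum (map (k *_) ns) ≡ k * sum ns
sum-map-* k []       = sym (*-zeroʳ k)
sum-map-* k (n ∷ ns) = trans (cong (k * n +_) (sum-map-* k ns)) (sym (*-distribˡ-+ k n (sum ns)))

-- The divisors of p ^ (1 + e) * m prime to p are those of m, the others are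
-- p times those of p ^ e * m.
σ-suc : ∀ {p m} e → Prime p → p ∤ m → 0 < m → σ (p ^ suc e * m) ≡ σ m + p * σ (p ^ e * m)
σ-suc {p} {m} e p-prime p∤m 0<m = trans
  (σ≡sum (pos (suc e)) (unique-++ (divisors-unique m) (unique-map (*-cancelˡ-≡ _ _ p) (divisors-unique n)) disjoint) ∈⇒∣ ∣⇒∈)
  (trans (sum-++ (divisors m) (map (p *_) (divisors n))) (cong (σ m +_) (sum-map-* p (divisors n))))
  where
  instance
    p≢0 : NonZero p
    p≢0 = prime⇒nonZero p-prime

  n : ℕ
  n = p ^ e * m

  pos : ∀ e → 0 < p ^ e * m
  pos e = *-mono-≤ (m^n>0 p e) 0<m

  disjoint : Disjoint (divisors m) (map (p *_) (divisors n))
  disjoint (d∈m , d∈pn) with ∈-map⁻ (p *_) d∈pn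
  ... | d′ , _ , refl = p∤m (m*n∣⇒m∣ p d′ (∈-divisors⇒∣ m d∈m))

  ∈⇒∣ : ∀ {d} → d ∈ divisors m ++ map (p *_) (divisors n) → d ∣ p ^ suc e * m
  ∈⇒∣ d∈ with ∈-++⁻ (divisors m) d∈
  ... | inj₁ d∈m  = ∣n⇒∣m*n (p ^ suc e) (∈-divisors⇒∣ m d∈m)
  ... | inj₂ d∈pn with ∈-map⁻ (p *_) d∈pn
  ...   | d′ , d′∈n , refl = subst (p * d′ ∣_) (sym (*-assoc p (p ^ e) m)) (*-monoʳ-∣ p (∈-divisors⇒∣ n d′∈n))

  ∣⇒∈ : ∀ {d} → d ∣ p ^ suc e * m → d ∈ divisors m ++ map (p *_) (divisors n)
  ∣⇒∈ {d} d∣ with p ∣? d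
  ... | yes (divides d′ refl) = ∈-++⁺ʳ (divisors m) (subst (_∈ map (p *_) (divisors n)) (*-comm p d′)
    (∈-map⁺ (p *_) (∣⇒∈-divisors (pos e) (*-cancelˡ-∣ p (subst₂ _∣_ (*-comm d′ p) (*-assoc p (p ^ e) m) d∣)))))
  ... | no p∤d = ∈-++⁺ˡ (∣⇒∈-divisors 0<m
    (coprime-divisor (Coprime.sym (coprime-^ˡ (suc e) (prime∧∤⇒coprime p-prime p∤d))) d∣))

σ-prime-power-* : ∀ {p m} e → Prime p → p ∤ m → 0 < m → σ (p ^ e * m) ≡ geom (suc e) p * σ m
σ-prime-power-* {p} {m} zero p-prime p∤m 0<m = begin
  σ (1 * m)         ≡⟨ cong σ (*-identityˡ m) ⟩
  σ m               ≡⟨ *-identityˡ (σ m) ⟨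
  1 * σ m           ≡⟨ cong (λ z → (1 + z) * σ m) (*-zeroʳ p) ⟨
  (1 + p * 0) * σ m ∎
  where open ≡-Reasoning
σ-prime-power-* {p} {m} (suc e) p-prime p∤m 0<m = begin
  σ (p ^ suc e * m)                 ≡⟨ σ-suc e p-prime p∤m 0<m ⟩
  σ m + p * σ (p ^ e * m)           ≡⟨ cong (λ s → σ m + p * s) (σ-prime-power-* e p-prime p∤m 0<m) ⟩
  σ m + p * (geom (suc e) p * σ m)  ≡⟨ cong (σ m +_) (*-assoc p _ (σ m)) ⟨
  σ m + p * geom (suc e) p * σ m    ∎
  where open ≡-Reasoning

-- Factorisation into prime powers

split-power : ∀ {p} n → Prime p → 0 < n → ∃₂ λ e m → n ≡ p ^ e * m × p ∤ m
split-power {p} n p-prime = <-rec (λ n → 0 < n → ∃₂ λ e m → n ≡ p ^ e * m × p ∤ m) go n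
  where
  go : ∀ n → (∀ {m} → m < n → 0 < m → ∃₂ λ e o → m ≡ p ^ e * o × p ∤ o) → 0 < n → ∃₂ λ e m → n ≡ p ^ e * m × p ∤ m
  go n rec 0<n with p ∣? n
  ... | no p∤n = 0 , n , sym (*-identityˡ n) , p∤n
  ... | yes (divides zero refl) = contradiction 0<n (<-irrefl refl)
  ... | yes (divides k@(suc _) refl) with rec {k} (m<m*n k p (prime≥2 p-prime)) z<s
  ...   | e , m , k≡ , p∤m = suc e , m , trans (*-comm k p) (trans (cong (p *_) k≡) (sym (*-assoc p (p ^ e) m))) , p∤m

PrimePower : Component → Set
PrimePower c = Prime (base c) × 1 ≤ proj₂ c

prime-∤-values : ∀ {p cs} → Prime p → All PrimePower cs → All (p ≢_) (map base cs) → p ∤ ∏ value cs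
prime-∤-values {p} p-prime pps p∉ = prime∤∏ {f = value} p-prime
  (All.zipWith (λ { {c} ((c-prime , _) , p≢) → p≢ ∘ prime∣prime⇒≡ p-prime c-prime ∘ prime∣^⇒∣ (base c) (proj₂ c) p-prime })
    (pps , All.map⁻ p∉))

base∣value : ∀ {c} → PrimePower c → base c ∣ value c
base∣value {p , suc e} _ = m∣m*n (p ^ e)

∏-value>0 : ∀ {cs} → All PrimePower cs → 0 < ∏ value cs
∏-value>0 [] = z<s
∏-value>0 {c ∷ _} ((c-prime , _) ∷ pps) = *-mono-≤ (m^n>0 (base c) ⦃ prime⇒nonZero c-prime ⦄ (proj₂ c)) (∏-value>0 pps)

σ-∏ : ∀ {cs} → All PrimePower cs → Unique (map base cs) → σ (∏ value cs) ≡ ∏ sigma cs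
σ-∏ [] [] = refl
σ-∏ {c ∷ cs} ((c-prime , _) ∷ pps) (c∉ ∷ unique) = trans
  (σ-prime-power-* (proj₂ c) c-prime (prime-∤-values c-prime pps c∉) (∏-value>0 pps))
  (cong (sigma c *_) (σ-∏ pps unique))

record Factored (n : ℕ) : Set where
  field
    components   : List Component
    prime-powers : All PrimePower components
    unique       : Unique (map base components)
    product≡     : ∏ value components ≡ n

factored : ∀ n → 0 < n → Factored n
factored = <-rec (λ n → 0 < n → Factored n) go
  where
  go : ∀ n → (∀ {m} → m < n → 0 < m → Factored m) → 0 < n → Factored n
  go (suc zero) rec _ = record { components = [] ; prime-powers = [] ; unique = [] ; product≡ = refl }
  go n@(suc (suc _)) rec 0<n with primeDivisor {n} (s≤s (s≤s z≤n))
  ... | p , p-prime , p∣n with split-power n p-prime 0<n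
  ...   | zero , m , n≡ , p∤m = contradiction (subst (p ∣_) (trans n≡ (*-identityˡ m)) p∣n) p∤m
  ...   | suc e , zero , n≡ , p∤m = contradiction (p ∣0) p∤m
  ...   | suc e , m@(suc _) , n≡ , p∤m = record
    { components   = (p , suc e) ∷ components
    ; prime-powers = (p-prime , s≤s z≤n) ∷ prime-powers
    ; unique       = All.map⁺ (All.tabulate p≢) ∷ unique
    ; product≡     = trans (cong (p ^ suc e *_) product≡) (sym n≡)
    }
    where
    m<n : m < n
    m<n = subst (m <_) (sym n≡) (subst (_< p ^ suc e * m) (*-identityˡ m)
      (*-monoˡ-< m (≤-trans (prime≥2 p-prime) (m≤m*n p (p ^ e) ⦃ m^n≢0 p e ⦃ prime⇒nonZero p-prime ⦄ ⦄))))
    open Factored (rec m<n z<s)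
    p≢ : ∀ {c} → c ∈ components → p ≢ base c
    p≢ c∈ refl = p∤m (subst (p ∣_) product≡
      (∣-trans (base∣value (All.lookup prime-powers c∈)) (∈⇒∣product (∈-map⁺ value c∈))))

-- Counting the prime factors

-- A pigeonhole principle for relations: the partner of the first `x` is removed from `ys`, and by
-- injectivity no later `x` is related to it.
length-≤-by-relation : ∀ {A B : Set} (_∼_ : A → B → Set) → (∀ {x x′ y} → x ∼ y → x′ ∼ y → x ≡ x′) →
  ∀ {xs ys} → Unique xs → (∀ {x} → x ∈ xs → ∃[ y ] y ∈ ys × x ∼ y) → length xs ≤ length ys
length-≤-by-relation _∼_ ∼-injective {[]} [] related = z≤n
length-≤-by-relation _∼_ ∼-injective {x ∷ xs} {ys} (x∉ ∷ unique) related with related (here refl)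
... | y , y∈ys , x∼y with ∈-∃++ y∈ys
...   | ys₁ , ys₂ , refl = begin
  suc (length xs)             ≤⟨ s≤s (length-≤-by-relation _∼_ ∼-injective unique related′) ⟩
  length (y ∷ ys₁ ++ ys₂)     ≡⟨ ↭-length (shift y ys₁ ys₂) ⟨
  length (ys₁ ++ y ∷ ys₂)     ∎
  where
  open ≤-Reasoning
  related′ : ∀ {x′} → x′ ∈ xs → ∃[ y′ ] y′ ∈ ys₁ ++ ys₂ × x′ ∼ y′
  related′ x′∈xs with related (there x′∈xs)
  ... | y′ , y′∈ys , x′∼y′ with ∈-resp-↭ (shift y ys₁ ys₂) y′∈ys
  ...   | here refl  = contradiction (∼-injective x∼y x′∼y′) (All.lookup x∉ x′∈xs)
  ...   | there y′∈  = y′ , y′∈ , x′∼y′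

module _ {A : Set} {P : A → Set} (P? : ∀ x → Dec (P x)) where
  filter-∷-≤ : ∀ x xs → length (filter P? xs) ≤ length (filter P? (x ∷ xs))
  filter-∷-≤ x xs with P? x
  ... | yes _ = n≤1+n _
  ... | no  _ = ≤-refl

  filter-∷-< : ∀ {x} xs → P x → length (filter P? xs) < length (filter P? (x ∷ xs))
  filter-∷-< xs px = ≤-reflexive (sym (cong length (filter-accept P? px)))

length-≤-cover : ∀ {A : Set} {P Q R : A → Set} (P? : ∀ x → Dec (P x)) (Q? : ∀ x → Dec (Q x)) (R? : ∀ x → Dec (R x)) →
  ∀ {xs} → All (λ x → P x ⊎ Q x ⊎ R x) xs →
  length xs ≤ length (filter P? xs) + length (filter Q? xs) + length (filter R? xs)
length-≤-cover P? Q? R? [] = z≤n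
length-≤-cover P? Q? R? {x ∷ xs} (px ∷ pxs) = ≤-<-trans (length-≤-cover P? Q? R? pxs) (grows px)
  where
  grows : _ → length (filter P? xs) + length (filter Q? xs) + length (filter R? xs)
            < length (filter P? (x ∷ xs)) + length (filter Q? (x ∷ xs)) + length (filter R? (x ∷ xs))
  grows (inj₁ p)        = +-mono-<-≤ (+-mono-<-≤ (filter-∷-< P? xs p) (filter-∷-≤ Q? x xs)) (filter-∷-≤ R? x xs)
  grows (inj₂ (inj₁ q)) = +-mono-<-≤ (+-mono-≤-< (filter-∷-≤ P? x xs) (filter-∷-< Q? xs q)) (filter-∷-≤ R? x xs)
  grows (inj₂ (inj₂ r)) = +-mono-≤-< (+-mono-≤ (filter-∷-≤ P? x xs) (filter-∷-≤ Q? x xs)) (filter-∷-< R? xs r)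

length-filter-map : ∀ {A B : Set} {P : B → Set} (P? : ∀ y → Dec (P y)) (f : A → B) xs →
                    length (filter (λ x → P? (f x)) xs) ≡ length (filter P? (map f xs))
length-filter-map P? f [] = refl
length-filter-map P? f (x ∷ xs) with P? (f x)
... | yes _ = cong suc (length-filter-map P? f xs)
... | no  _ = length-filter-map P? f xs

-- Every factor other than 1 at least doubles the product, which starts at 1.
length-≢1<∏ : ∀ {A : Set} (f : A → ℕ) {xs} → All (λ x → 0 < f x) xs →
              length (filter (λ x → ¬? (f x ≟ 1)) xs) < ∏ f xs
length-≢1<∏ f [] = z<s
length-≢1<∏ f {x ∷ xs} (fx>0 ∷ pos) with f x | fx>0 | length-≢1<∏ f pos
... | suc zero    | _ | ih = ≤-trans ih (m≤m+n _ _)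
... | suc (suc n) | _ | ih = begin-strict
  suc l             ≤⟨ ih ⟩
  π                 <⟨ m<m+n π (≤-trans z<s ih) ⟩
  π + π             ≤⟨ +-monoʳ-≤ π (m≤m+n π _) ⟩
  π + (π + n * π)   ∎
  where
  open ≤-Reasoning
  l π : ℕ
  l = length (filter (λ x → ¬? (f x ≟ 1)) xs)
  π = ∏ f xs

prime∣values⇒∈ : ∀ {ℓ cs} → Prime ℓ → All PrimePower cs → ℓ ∣ ∏ value cs → ℓ ∈ map base cs
prime∣values⇒∈ ℓ-prime [] ℓ∣1 = contradiction (subst Prime (∣1⇒≡1 ℓ∣1) ℓ-prime) ¬prime[1]
prime∣values⇒∈ {ℓ} {c ∷ cs} ℓ-prime ((c-prime , _) ∷ pps) ℓ∣ with euclidsLemma (value c) (∏ value cs) ℓ-prime ℓ∣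
... | inj₁ ℓ∣value = here (prime∣prime⇒≡ ℓ-prime c-prime (prime∣^⇒∣ (base c) (proj₂ c) ℓ-prime ℓ∣value))
... | inj₂ ℓ∣rest  = there (prime∣values⇒∈ ℓ-prime pps ℓ∣rest)

-- The number of prime divisors of m in terms of t

p²∣z²w : ∀ p y w → p * p ∣ p * y * (p * y) * w
p²∣z²w p y w = divides (y * y * w) (eq p y w)
  where
  eq : ∀ p y w → p * y * (p * y) * w ≡ y * y * w * (p * p)
  eq = solve-∀

-- Here (q ^ β) ^ n is 1 modulo p ^ 2 because q ^ n is, and it is 1 + n p
-- because σ (p ^ e) is 1 + p.
sigma-power⇒∣ : ∀ {p q β} e n → Prime p → q ^ β ≡ geom (3 + e) p → q ^ n ≡1mod (p * p) → p ∣ n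
sigma-power⇒∣ {p} {q} {β} e n p-prime q^β≡ q^n≡1 with ^-second-order (p * (1 + p * geom (1 + e) p)) n
... | w , expansion = [ id , (λ p∣1+py → contradiction (subst Prime (∣1⇒≡1 (p∣1 p∣1+py)) p-prime) ¬prime[1]) ]′
    (euclidsLemma n y p-prime (*-cancelʳ-∣ p ⦃ prime⇒nonZero p-prime ⦄ (subst (p * p ∣_) (eq n p y) p²∣nz)))
  where
  y z : ℕ
  -- `geom (3 + e) p` unfolds to `1 + p * y`, where `y` is 1 modulo `p` and so prime to it.
  y = 1 + p * geom (1 + e) p
  z = p * y

  p∣1 : p ∣ 1 + p * geom (1 + e) p → p ∣ 1
  p∣1 p∣1+py = ∣m+n∣m⇒∣n (subst (p ∣_) (+-comm 1 (p * geom (1 + e) p)) p∣1+py) (m∣m*n _)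

  eq : ∀ n p y → n * (p * y) ≡ n * y * p
  eq = solve-∀

  q^βn≡1 : 1 + n * z + z * z * w ≡1mod (p * p)
  q^βn≡1 = subst (_≡1mod (p * p))
    (trans (cong (q ^_) (*-comm n β)) (trans (sym (^-*-assoc q β n)) (trans (cong (_^ n) q^β≡) expansion)))
    (≡1mod-^* n β q^n≡1)

  p²∣nz : p * p ∣ n * z
  p²∣nz = ∣m+n∣m⇒∣n (subst (p * p ∣_) (+-comm (n * z) (z * z * w)) (≡1mod⇒∣ q^βn≡1)) (p²∣z²w p y w)

-- The components are those of m, and `t` is the index σ(m) / q^α. Cancelling q^α in σ(q^α) σ(m) = 2
-- q^α m yields `value≡`.
module CountPrimes {q α t : ℕ} {cs : List Component}
  (q-prime : Prime q) (q-odd : 2 ∤ q)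
  (pps : All PrimePower cs) (odds : All Odd cs) (unique : Unique (map base cs)) (t>0 : 0 < t)
  (sigma≡ : ∏ sigma cs ≡ t * q ^ α) (value≡ : 2 * ∏ value cs ≡ t * geom (suc α) q)
  where

  private
    n : ℕ
    n = suc α

    q≥3 : 3 ≤ q
    q≥3 = ≤∧≢⇒< (prime≥2 q-prime) λ { refl → q-odd ∣-refl }

    1+pred-q : suc (pred q) ≡ q
    1+pred-q = suc-pred q ⦃ prime⇒nonZero q-prime ⦄

    q^n≡1mod : ∀ {d} → d ∣ geom n q → q ^ n ≡1mod d
    q^n≡1mod {d} d∣ = subst (λ q → q ^ n ≡1mod d) 1+pred-q
      (∣geom⇒^≡1mod (pred q) n (subst (λ q → d ∣ geom n q) (sym 1+pred-q) d∣))

    split : ∀ c → ∃₂ λ β u → sigma c ≡ q ^ β * u × q ∤ u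
    split c = split-power (sigma c) q-prime z<s

    β u : Component → ℕ
    β c = proj₁ (split c)
    u c = proj₁ (proj₂ (split c))

    u>0 : ∀ c → 0 < u c
    u>0 c = n≢0⇒n>0 λ u≡0 → proj₂ (proj₂ (proj₂ (split c))) (subst (q ∣_) (sym u≡0) (q ∣0))

    ∏-split : ∀ cs → ∏ sigma cs ≡ q ^ sum (map β cs) * ∏ u cs
    ∏-split [] = refl
    ∏-split (c ∷ cs) = begin
      sigma c * ∏ sigma cs                                ≡⟨ cong₂ _*_ (proj₁ (proj₂ (proj₂ (split c)))) (∏-split cs) ⟩
      q ^ β c * u c * (q ^ sum (map β cs) * ∏ u cs)       ≡⟨ [m*n]*[o*p]≡[m*o]*[n*p] (q ^ β c) (u c) (q ^ sum (map β cs)) (∏ u cs) ⟩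
      q ^ β c * q ^ sum (map β cs) * (u c * ∏ u cs)       ≡⟨ cong (_* (u c * ∏ u cs)) (^-distribˡ-+-* q (β c) _) ⟨
      q ^ (β c + sum (map β cs)) * (u c * ∏ u cs)         ∎
      where open ≡-Reasoning

    -- The product of the `u` divides `t * q ^ α` and is prime to `q`.
    ∏u≤t : ∏ u cs ≤ t
    ∏u≤t = ∣⇒≤ ⦃ >-nonZero t>0 ⦄ (coprime-divisor
      (Coprime.sym (coprime-^ˡ α (prime∧∤⇒coprime q-prime (prime∤∏ {f = u} {xs = cs} q-prime (All.tabulate λ {c} _ → proj₂ (proj₂ (proj₂ (split c))))))))
      (subst (∏ u cs ∣_) (trans (sym (∏-split cs)) (trans sigma≡ (*-comm t (q ^ α)))) (n∣m*n (q ^ sum (map β cs)))))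

    classify : ∀ {c} → c ∈ cs → base c ∣ n ⊎ base c ∣ t ⊎ u c ≢ 1
    classify {c} c∈ with base c ∣? t | u c ≟ 1
    ... | yes p∣t | _      = inj₂ (inj₁ p∣t)
    ... | no _    | no u≢1 = inj₂ (inj₂ u≢1)
    ... | no p∤t  | yes u≡1 = inj₁ (power c {β c} (All.lookup pps c∈) (All.lookup odds c∈) p∤t value∣ sigma-power)
      where
      value∣ : value c ∣ t * geom n q
      value∣ = subst (value c ∣_) value≡ (∣n⇒∣m*n 2 (∈⇒∣product (∈-map⁺ value c∈)))
      sigma-power : q ^ β c ≡ sigma c
      sigma-power = trans (sym (*-identityʳ (q ^ β c))) (trans (cong (q ^ β c *_) (sym u≡1)) (sym (proj₁ (proj₂ (proj₂ (split c))))))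
      power : ∀ c {β} → PrimePower c → Odd c → base c ∤ t → value c ∣ t * geom n q → q ^ β ≡ sigma c → base c ∣ n
      power (p , zero) (_ , ()) _ _ _ _
      -- For exponent 1, σ(p) = p + 1 is even and cannot be a power of the odd `q`.
      power (suc r , suc zero) {β} _ c-odd _ _ q^β≡ = contradiction
        (prime∣^⇒∣ q β prime[2] (subst (2 ∣_) (trans (eq r) (sym q^β≡)) (∣m∣n⇒∣m+n ∣-refl (2∣pred-odd (2∤base c-odd)))))
        q-odd
        where
        eq : ∀ r → 2 + r ≡ 1 + (1 + r) * (1 + (1 + r) * 0)
        eq = solve-∀
      -- Now `p * p` divides `t * geom n q` and is prime to `t`, so `q ^ n` is 1 modulo `p * p`.
      power (p , suc (suc e)) {β} (p-prime , _) _ p∤t value∣ q^β≡ =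
        sigma-power⇒∣ {β = β} e n p-prime q^β≡ (q^n≡1mod (coprime-divisor p²⊥t (∣-trans p²∣ value∣)))
        where
        p²⊥t : Coprime (p * p) t
        p²⊥t = subst (λ m → Coprime m t) (cong (p *_) (*-identityʳ p)) (coprime-^ˡ 2 (prime∧∤⇒coprime p-prime p∤t))
        p²∣ : p * p ∣ p ^ suc (suc e)
        p²∣ = divides (p ^ e) (trans (sym (*-assoc p p (p ^ e))) (*-comm (p * p) (p ^ e)))

    dividing : List ℕ
    dividing = filter (_∣? n) (map base cs)

    ∈-dividing : ∀ {p} → p ∈ dividing → Prime p × 3 ≤ p × p ∣ n
    ∈-dividing p∈ with ∈-filter⁻ (_∣? n) {xs = map base cs} p∈
    ... | p∈bases , p∣n with ∈-map⁻ base p∈bases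
    ...   | c , c∈ , refl = proj₁ (All.lookup pps c∈) , 3≤base (All.lookup odds c∈) , p∣n

    HasOrder : ℕ → ℕ → Set
    HasOrder d ℓ = q ^ d ≡1mod ℓ × (∀ {e} → q ^ e ≡1mod ℓ → d ∣ e)

    order-unique : ∀ {d d′ ℓ} → HasOrder d ℓ → HasOrder d′ ℓ → d ≡ d′
    order-unique (q^d≡1 , d-least) (q^d′≡1 , d′-least) = ∣-antisym (d-least q^d′≡1) (d′-least q^d≡1)

    -- As `p * s` divides `n`, the primitive prime `ℓ` divides `q ^ n - 1`; as its order is not 1,
    -- it does not divide `q - 1`. Hence it divides `geom n q` and so 2m, and it is not 2 because
    -- `q - 1` is even.
    primitive-base : ∀ {p s} → p ∈ dividing → s ∈ dividing → p ≢ s →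
                     ∃[ ℓ ] ℓ ∈ map base cs × HasOrder (p * s) ℓ
    primitive-base {p} {s} p∈ s∈ p≢s with ∈-dividing p∈ | ∈-dividing s∈
    ... | p-prime , 3≤p , p∣n | s-prime , 3≤s , s∣n =
      ℓ , prime∣values⇒∈ ℓ-prime pps ℓ∣values , q^d≡1 , order
      where
      open PrimitivePrime (primitivePrime {p} {s} {q} p-prime s-prime p≢s 3≤p 3≤s q≥3)

      ps∣n : p * s ∣ n
      ps∣n = coprime-∣* (primes-coprime p-prime s-prime p≢s) p∣n s∣n

      q^n≡1 : suc (pred q) ^ n ≡1mod ℓ
      q^n≡1 with ps∣n
      ... | divides k n≡k*ps = subst₂ (λ q n → q ^ n ≡1mod ℓ) (sym 1+pred-q) (trans (*-comm (p * s) k) (sym n≡k*ps)) (≡1mod-^* (p * s) k q^d≡1)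

      ℓ∤pred-q : ℓ ∤ pred q
      ℓ∤pred-q ℓ∣ = contradiction (subst Prime (∣1⇒≡1 (m*n∣⇒m∣ p s ps∣1)) p-prime) ¬prime[1]
        where
        ps∣1 : p * s ∣ 1
        ps∣1 = order (subst (_≡1mod ℓ) (trans 1+pred-q (sym (*-identityʳ q))) (∣⇒≡1mod ℓ∣))

      ℓ∣geom : ℓ ∣ geom n q
      ℓ∣geom with euclidsLemma (pred q) _ ℓ-prime (≡1mod⇒∣ (subst (_≡1mod ℓ) (^-geom (pred q) n) q^n≡1))
      ... | inj₁ ℓ∣pred-q = contradiction ℓ∣pred-q ℓ∤pred-q
      ... | inj₂ ℓ∣       = subst (λ q → ℓ ∣ geom n q) 1+pred-q ℓ∣

      ℓ∣values : ℓ ∣ ∏ value cs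
      ℓ∣values with euclidsLemma 2 (∏ value cs) ℓ-prime (subst (ℓ ∣_) (sym value≡) (∣n⇒∣m*n t ℓ∣geom))
      ... | inj₂ ℓ∣ = ℓ∣
      ... | inj₁ ℓ∣2 = contradiction (subst (_∣ pred q) (sym (prime∣prime⇒≡ ℓ-prime prime[2] ℓ∣2)) (2∣pred-odd q-odd)) ℓ∤pred-q

    -- The products of `r` and of `s` with the remaining primes are distinct orders, each attained
    -- modulo some prime of m, and one prime has only one order. The 4 accounts for `r` and `s`
    -- themselves.
    few-dividing : ∀ ps → Unique ps → (∀ {p} → p ∈ ps → p ∈ dividing) → 2 * length ps ≤ length cs + 4
    few-dividing []      _ _ = z≤n
    few-dividing (_ ∷ []) _ _ = ≤-trans (m≤m+n 2 2) (m≤n+m 4 (length cs))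
    few-dividing (r ∷ s ∷ ps) ((r≢s ∷ r∉) ∷ s∉ ∷ ps-unique) ∈dividing = begin
      2 * (2 + length ps)        ≡⟨ eq (length ps) ⟩
      length ps + length ps + 4  ≡⟨ cong (_+ 4) length-ds ⟨
      length ds + 4              ≤⟨ +-monoˡ-≤ 4 (length-≤-by-relation HasOrder order-unique ds-unique ds-order) ⟩
      length (map base cs) + 4   ≡⟨ cong (_+ 4) (length-map base cs) ⟩
      length cs + 4              ∎
      where
      open ≤-Reasoning
      eq : ∀ n → 2 * (2 + n) ≡ n + n + 4
      eq = solve-∀

      ∈⇒prime : ∀ {p} → p ∈ r ∷ s ∷ ps → Prime p
      ∈⇒prime p∈ = proj₁ (∈-dividing (∈dividing p∈))

      ds : List ℕ
      ds = map (r *_) ps ++ map (s *_) ps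

      length-ds : length ds ≡ length ps + length ps
      length-ds = trans (length-++ (map (r *_) ps)) (cong₂ _+_ (length-map (r *_) ps) (length-map (s *_) ps))

      disjoint : Disjoint (map (r *_) ps) (map (s *_) ps)
      disjoint (d∈r , d∈s) with ∈-map⁻ (r *_) d∈r | ∈-map⁻ (s *_) d∈s
      ... | p , p∈ , refl | p′ , p′∈ , r*p≡s*p′
        with euclidsLemma s p′ (∈⇒prime (here refl)) (subst (r ∣_) r*p≡s*p′ (m∣m*n p))
      ...   | inj₁ r∣s  = r≢s (prime∣prime⇒≡ (∈⇒prime (here refl)) (∈⇒prime (there (here refl))) r∣s)
      ...   | inj₂ r∣p′ = All.lookup r∉ p′∈ (prime∣prime⇒≡ (∈⇒prime (here refl)) (∈⇒prime (there (there p′∈))) r∣p′)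

      ds-unique : Unique ds
      ds-unique = unique-++
        (unique-map (*-cancelˡ-≡ _ _ r ⦃ prime⇒nonZero (∈⇒prime (here refl)) ⦄) ps-unique)
        (unique-map (*-cancelˡ-≡ _ _ s ⦃ prime⇒nonZero (∈⇒prime (there (here refl))) ⦄) ps-unique)
        disjoint

      ds-order : ∀ {d} → d ∈ ds → ∃[ ℓ ] ℓ ∈ map base cs × HasOrder d ℓ
      ds-order d∈ with ∈-++⁻ (map (r *_) ps) d∈
      ... | inj₁ d∈r with ∈-map⁻ (r *_) d∈r
      ...   | p , p∈ , refl = primitive-base (∈dividing (here refl)) (∈dividing (there (there p∈))) (All.lookup r∉ p∈)
      ds-order d∈ | inj₂ d∈s with ∈-map⁻ (s *_) d∈s
      ...   | p , p∈ , refl = primitive-base (∈dividing (there (here refl))) (∈dividing (there (there p∈))) (All.lookup s∉ p∈)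

    few-divisors-of-t : length (filter (_∣? t) (map base cs)) ≤ suc t
    few-divisors-of-t = subst (length (filter (_∣? t) (map base cs)) ≤_) (length-upTo (suc t))
      (length-≤-by-relation _≡_ (λ { refl refl → refl }) (filter⁺ (_∣? t) unique)
        λ {p} p∈ → p , ∈-upTo⁺ (s≤s (∣⇒≤ ⦃ >-nonZero t>0 ⦄ (proj₂ (∈-filter⁻ (_∣? t) {xs = map base cs} p∈)))) , refl)

  -- Doubling `length cs ≤ r + (1 + 2 * t)` and inserting `2 * r ≤ length cs + 4` leaves one
  -- `length cs` to cancel.
  length≤ : length cs ≤ 4 * t + 6
  length≤ = +-cancelˡ-≤ (length cs) _ _ (begin
    length cs + length cs               ≤⟨ +-mono-≤ cover cover ⟩
    (r + (1 + 2 * t)) + (r + (1 + 2 * t)) ≡⟨ eq r t ⟩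
    2 * r + (4 * t + 2)                 ≤⟨ +-monoˡ-≤ (4 * t + 2) (few-dividing dividing (filter⁺ (_∣? n) unique) id) ⟩
    length cs + 4 + (4 * t + 2)         ≡⟨ eq′ (length cs) t ⟩
    length cs + (4 * t + 6)             ∎)
    where
    open ≤-Reasoning
    r : ℕ
    r = length dividing
    eq : ∀ r t → (r + (1 + 2 * t)) + (r + (1 + 2 * t)) ≡ 2 * r + (4 * t + 2)
    eq = solve-∀
    eq′ : ∀ l t → l + 4 + (4 * t + 2) ≡ l + (4 * t + 6)
    eq′ = solve-∀
    eq″ : ∀ r t → r + suc t + t ≡ r + (1 + 2 * t)
    eq″ = solve-∀
    cover : length cs ≤ r + (1 + 2 * t)
    cover = begin
      length cs           ≤⟨ length-≤-cover (λ c → base c ∣? n) (λ c → base c ∣? t) (λ c → ¬? (u c ≟ 1)) (All.tabulate classify) ⟩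
      length (filter (λ c → base c ∣? n) cs) + length (filter (λ c → base c ∣? t) cs) + length (filter (λ c → ¬? (u c ≟ 1)) cs)
                          ≤⟨ +-mono-≤ (+-mono-≤ (≤-reflexive (length-filter-map (_∣? n) base cs)) (≤-trans (≤-reflexive (length-filter-map (_∣? t) base cs)) few-divisors-of-t))
                                      (≤-trans (<⇒≤ (length-≢1<∏ u {cs} (All.tabulate λ {c} _ → u>0 c))) ∏u≤t) ⟩
      r + suc t + t       ≡⟨ eq″ r t ⟩
      r + (1 + 2 * t)     ∎

-- Odd perfect numbers of small index

open import Data.Integer.Base using (+_)
open import Data.Rational.Base using (_/_)

-- `4 * M + 7` bounds the number of primes of N: at most `4 * t + 6` in m with `t < M`, and `q`.
-- Every component starts in C and needs two moves, hence the factor 2 in the fuel; the initial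
-- bound 1 is an empty product.
perfectBound : ℕ → ℕ
perfectBound M = iterateStep (2 * (4 * M + 7)) (4 * M + 7) 1

perfect≤perfectBound : ∀ {M q α m} → Prime q → 1 ≤ α → 0 < m → q ∤ m → 2 ∤ q ^ α * m →
  σ (q ^ α * m) ≡ 2 * (q ^ α * m) → σ m < M * q ^ α → q ^ α * m ≤ perfectBound M
perfect≤perfectBound {M} {q} {α} {m} q-prime 1≤α m>0 q∤m N-odd perfect σm<
  with coprime-divisor {q ^ α} {geom (suc α) q} {σ m} (coprime-^ˡ α (prime∧∤⇒coprime q-prime q∤geom))
         (subst (q ^ α ∣_) (trans (sym perfect) (σ-prime-power-* α q-prime q∤m m>0)) (∣n⇒∣m*n 2 (m∣m*n m)))
  where
  q∤geom : q ∤ geom (suc α) q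
  q∤geom q∣geom = contradiction (subst Prime (∣1⇒≡1
    (∣m+n∣m⇒∣n (subst (q ∣_) (+-comm 1 (q * geom α q)) q∣geom) (m∣m*n (geom α q)))) q-prime) ¬prime[1]
... | divides t σm≡ = begin
  q ^ α * m                                ≡⟨ cong (q ^ α *_) product≡ ⟨
  q ^ α * ∏ value cs                       ≡⟨ *-identityˡ _ ⟨
  1 * 1 * (q ^ α * ∏ value cs)             ≤⟨ perfect-bound (2 * k) k 1 {[]} {[]} {(q , α) ∷ cs} [] [] (qα-odd ∷ odds) length≤k (*-monoʳ-≤ 2 length≤k) ≤-refl perfect′ ⟩
  perfectBound M                           ∎
  where
  open ≤-Reasoning
  open Factored (factored m m>0) renaming (components to cs)

  k : ℕ
  k = 4 * M + 7

  instance
    q≢0 : NonZero q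
    q≢0 = prime⇒nonZero q-prime
    q^α≢0 : NonZero (q ^ α)
    q^α≢0 = m^n≢0 q α

  prime-odd : ∀ {c} → PrimePower c → value c ∣ q ^ α * m → Odd c
  prime-odd {c} c-pp@(c-prime , 1≤e) value∣ =
    odd (≤∧≢⇒< (prime≥2 c-prime) λ { refl → 2∤base′ ∣-refl }) 2∤base′ 1≤e
    where
    2∤base′ : 2 ∤ base c
    2∤base′ 2∣base = N-odd (∣-trans 2∣base (∣-trans (base∣value c-pp) value∣))

  qα-odd : Odd (q , α)
  qα-odd = prime-odd (q-prime , 1≤α) (m∣m*n m)

  odds : All Odd cs
  odds = All.tabulate λ {c} c∈ → prime-odd (All.lookup prime-powers c∈)
    (∣n⇒∣m*n (q ^ α) (subst (value c ∣_) product≡ (∈⇒∣product (∈-map⁺ value c∈))))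

  sigma≡ : ∏ sigma cs ≡ t * q ^ α
  sigma≡ = trans (sym (σ-∏ prime-powers unique)) (trans (cong σ product≡) σm≡)

  t<M : t < M
  t<M = *-cancelʳ-< (q ^ α) t M (subst (_< M * q ^ α) σm≡ σm<)

  t>0 : 0 < t
  t>0 = n≢0⇒n>0 λ { refl → >⇒≢ (sigma>0 odds) sigma≡ }

  sigma-value : geom (suc α) q * (t * q ^ α) ≡ 2 * (q ^ α * m)
  sigma-value = begin-equality
    geom (suc α) q * (t * q ^ α) ≡⟨ cong (geom (suc α) q *_) σm≡ ⟨
    geom (suc α) q * σ m         ≡⟨ σ-prime-power-* α q-prime q∤m m>0 ⟨
    σ (q ^ α * m)                ≡⟨ perfect ⟩
    2 * (q ^ α * m)              ∎

  value≡ : 2 * ∏ value cs ≡ t * geom (suc α) q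
  value≡ = *-cancelʳ-≡ _ _ (q ^ α) (begin-equality
    2 * ∏ value cs * q ^ α       ≡⟨ cong (λ m → 2 * m * q ^ α) product≡ ⟩
    2 * m * q ^ α                ≡⟨ eq m (q ^ α) ⟩
    2 * (q ^ α * m)              ≡⟨ sigma-value ⟨
    geom (suc α) q * (t * q ^ α) ≡⟨ eq′ (geom (suc α) q) t (q ^ α) ⟩
    t * geom (suc α) q * q ^ α   ∎)
    where
    eq : ∀ m a → 2 * m * a ≡ 2 * (a * m)
    eq = solve-∀
    eq′ : ∀ g t a → g * (t * a) ≡ t * g * a
    eq′ = solve-∀

  length≤k : suc (length cs) ≤ k
  length≤k = begin
    suc (length cs)    ≤⟨ s≤s (CountPrimes.length≤ {q} {α} q-prime (2∤base qα-odd) prime-powers odds unique t>0 sigma≡ value≡) ⟩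
    suc (4 * t + 6)    ≡⟨ +-suc (4 * t) 6 ⟨
    4 * t + 7          ≤⟨ +-monoˡ-≤ 7 (*-monoʳ-≤ 4 (<⇒≤ t<M)) ⟩
    4 * M + 7          ∎

  perfect′ : 1 * 1 * (geom (suc α) q * ∏ sigma cs) ≡ 2 * (1 * 1 * (q ^ α * ∏ value cs))
  perfect′ = begin-equality
    1 * 1 * (geom (suc α) q * ∏ sigma cs)  ≡⟨ *-identityˡ _ ⟩
    geom (suc α) q * ∏ sigma cs            ≡⟨ cong (geom (suc α) q *_) sigma≡ ⟩
    geom (suc α) q * (t * q ^ α)           ≡⟨ sigma-value ⟩
    2 * (q ^ α * m)                        ≡⟨ cong (λ m → 2 * (q ^ α * m)) product≡ ⟨
    2 * (q ^ α * ∏ value cs)               ≡⟨ cong (2 *_) (*-identityˡ (q ^ α * ∏ value cs)) ⟨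
    2 * (1 * 1 * (q ^ α * ∏ value cs))     ∎

-- Comparison with the real number K

-- A rational is at most the absolute value of its numerator, since its denominator is at least 1;
-- this turns `r` into a natural bound.
/<⇒< : ∀ s d .⦃ _ : NonZero d ⦄ r → (+ s) ℚ./ d ℚ.< r → s < ℤ.∣ ℚ.↥ r ∣ * d
/<⇒< s d@(suc _) r@record{} s/d<r with ℚᵘ.<-respˡ-≃ (ℚ.toℚᵘ-fromℚᵘ (ℚᵘ.mkℚᵘ (+ s) (pred d))) (ℚ.toℚᵘ-mono-< s/d<r)
... | ℚᵘ.*<* s*↧r<↥r*d = begin-strict
  s                 ≤⟨ m≤m*n s (ℚ.↧ₙ r) ⟩
  s * ℚ.↧ₙ r        <⟨ ℤ.drop‿+<+ (ℤ.≤-<-trans (ℤ.≤-reflexive (ℤ.pos-* s (ℚ.↧ₙ r))) (ℤ.<-≤-trans s*↧r<↥r*d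
                         (ℤ.≤-trans (ℤ.*-monoʳ-≤-nonNeg (+ d) (i≤∣i∣ (ℚ.↥ r))) (ℤ.≤-reflexive (sym (ℤ.pos-* ℤ.∣ ℚ.↥ r ∣ d)))))) ⟩
  ℤ.∣ ℚ.↥ r ∣ * d   ∎
  where
  open ≤-Reasoning
  i≤∣i∣ : ∀ i → i ℤ.≤ + ℤ.∣ i ∣
  i≤∣i∣ (+ n)      = ℤ.≤-refl
  i≤∣i∣ ℤ.-[1+ n ] = ℤ.-≤+

-- Roundedness makes the lower cut closed downwards, so `r ≤ p` would put `r` into both cuts.
<ℝ∧Upper⇒< : ∀ (K : ℝ) {p r} → p <ℝ K → ℝ.Upper K r → p ℚ.< r
<ℝ∧Upper⇒< K {p} {r} p<K K<r with ℚ.<-cmp p r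
... | tri< p<r _ _   = p<r
... | tri≈ _ refl _  = contradiction (p<K , K<r) (ℝ.disjoint K p)
... | tri> _ _ r<p   = contradiction (Equivalence.from (ℝ.lowerRounded K r) (p , r<p , p<K) , K<r) (ℝ.disjoint K r)

-- Effective because a real carries a rational upper bound as data; its numerator serves as `M`.
bound : ℝ → ℕ
bound K = perfectBound ℤ.∣ ℚ.↥ proj₁ (ℝ.upperInhabited K) ∣

N≤bound : ∀ K N → OddPerfect N → SmallIndex K N → N ≤ bound K
N≤bound K N (N-odd , N≢0 , perfect) (q , α , q-prime , 1≤α , (q^α∣N@(divides m N≡m*q^α) , q^1+α∤N) , index<K) =
  subst (_≤ bound K) (sym N≡) (perfect≤perfectBound {M = ℤ.∣ ℚ.↥ proj₁ (ℝ.upperInhabited K) ∣} q-prime 1≤α m>0 q∤m (N-odd ∘ subst (2 ∣_) (sym N≡))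
    (subst (λ N → σ N ≡ 2 * N) N≡ perfect)
    (subst (λ m → σ m < _) (n/m≡quotient q^α∣N) (/<⇒< _ (q ^ α) _ (<ℝ∧Upper⇒< K index<K (proj₂ (ℝ.upperInhabited K))))))
  where
  instance
    q^α≢0 : NonZero (q ^ α)
    q^α≢0 = m^n≢0 q α ⦃ prime⇒nonZero q-prime ⦄

  N≡ : N ≡ q ^ α * m
  N≡ = trans N≡m*q^α (*-comm m (q ^ α))

  m>0 : 0 < m
  m>0 = n≢0⇒n>0 λ { refl → ≢-nonZero⁻¹ N ⦃ N≢0 ⦄ N≡m*q^α }

  q∤m : q ∤ m
  q∤m q∣m = q^1+α∤N (subst (q * q ^ α ∣_) (sym N≡m*q^α) (*-monoˡ-∣ (q ^ α) q∣m))

theorem1p2 : Σ[ bound ∈ (ℝ → ℕ) ]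
    ((K : ℝ) → (+ 5 / 1) <ℝ K →
    FinitelyMany (λ N → OddPerfect N × SmallIndex K N)
    × ((N : ℕ) → OddPerfect N → SmallIndex K N → N ≤ bound K))
theorem1p2 = bound , λ K _ →
  (upTo (suc (bound K)) , λ N (perfect , small) → ∈-upTo⁺ (s≤s (N≤bound K N perfect small))) ,
  N≤bound K
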